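{- Let $(\mathcal{S}^x,H)$ be a finite thick STGQ of order $(t^2,t)$ satisfying property (*). Then it is central, i.e. its group $\mathbb{S}$ of symmetries with center $x$ is contained in $Z(H)$.
   Context: A finite GQ of order $(s,t)$: every line has $s+1$ points, every point lies on $t+1$ lines, and for each point $p$ and line $L$ not through $p$ exactly one point of $L$ is collinear with $p$; thick means $s,t\ge2$. An EGQ $(\mathcal{S}^x,H)$: $H\le\mathrm{Aut}(\mathcal{S})$ fixes every line through $x$ and acts sharply transitively on the points not collinear with $x$. A symmetry with center $x$ fixes every point collinear with $x$; an STGQ is an EGQ of order $(s,t)$ whose elation group contains a group $\mathbb{S}$ of $t$ symmetries with center $x$. Property (*): whenever an element of $H$ fixes a point $y\ne x$ collinear with $x$, it fixes every point of $xy$. -}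

module Defs where

open import Data.Nat using (ℕ; zero; suc; _+_; _≥_)
open import Data.Fin using (Fin; zero; suc)
open import Data.Bool using (Bool; true; false; _∧_; T; if_then_else_)
open import Data.Product using (Σ; ∃; _×_; _,_)
open import Relation.Binary.PropositionalEquality using (_≡_; _≢_)
open import Relation.Nullary using (¬_)

count : (n : ℕ) → (Fin n → Bool) → ℕ
count zero    f = 0
count (suc n) f = (if f zero then 1 else 0) + count n (λ i → f (suc i))

anyFin : (n : ℕ) → (Fin n → Bool) → Bool
anyFin zero    f = false
anyFin (suc n) f = f zero Data.Bool.∨ anyFin n (λ i → f (suc i))

record IncStr : Set where
  field
    np nl : ℕ
    I     : Fin np → Fin nl → Bool

module _ (S : IncStr) where
  open IncStr S

  Pt = Fin np
  Ln = Fin nl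

  -- p ~ q : some line is incident with both (so p ~ p holds)
  collinear : Pt → Pt → Bool
  collinear p q = anyFin nl (λ L → I p L ∧ I q L)

  record IsGQ (s t : ℕ) : Set where
    field
      linePts    : ∀ L → count np (λ p → I p L) ≡ suc s
      ptLines    : ∀ p → count nl (λ L → I p L) ≡ suc t
      partialLin : ∀ p q L M → T (I p L) → T (I q L) → T (I p M) → T (I q M)
                   → p ≢ q → L ≡ M
      gqAxiom    : ∀ p L → ¬ T (I p L) →
                   count np (λ q → I q L ∧ collinear p q) ≡ 1

  record Aut : Set where
    field
      pf   : Pt → Pt
      lf   : Ln → Ln
      pinv : Pt → Pt
      linv : Ln → Ln
      pinvˡ : ∀ p → pinv (pf p) ≡ p
      pinvʳ : ∀ p → pf (pinv p) ≡ p
      linvˡ : ∀ L → linv (lf L) ≡ L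
      linvʳ : ∀ L → lf (linv L) ≡ L
      pres  : ∀ p L → I (pf p) (lf L) ≡ I p L
  open Aut public

  _≈A_ : Aut → Aut → Set
  g ≈A h = (∀ p → pf g p ≡ pf h p) × (∀ L → lf g L ≡ lf h L)

  IsComp : Aut → Aut → Aut → Set
  IsComp k g h = (∀ p → pf k p ≡ pf g (pf h p)) × (∀ L → lf k L ≡ lf g (lf h L))

  IsId : Aut → Set
  IsId e = (∀ p → pf e p ≡ p) × (∀ L → lf e L ≡ L)

  record IsSubgroup (G : Aut → Set) : Set where
    field
      hasId  : Σ Aut (λ e → G e × IsId e)
      closed : ∀ g h → G g → G h → Σ Aut (λ k → G k × IsComp k g h)
      invs   : ∀ g → G g → Σ Aut (λ k → G k × Σ Aut (λ e → IsId e × IsComp e k g))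

  record IsEGQ (s t : ℕ) (x : Pt) (H : Aut → Set) : Set where
    field
      gq       : IsGQ s t
      subgroup : IsSubgroup H
      fixLines : ∀ h → H h → ∀ L → T (I x L) → lf h L ≡ L
      trans    : ∀ y z → ¬ T (collinear x y) → ¬ T (collinear x z) →
                 Σ Aut (λ h → H h × pf h y ≡ z)
      sharp    : ∀ y h h' → ¬ T (collinear x y) → H h → H h' →
                 pf h y ≡ pf h' y → h ≈A h'

  IsSymmetry : Pt → Aut → Set
  IsSymmetry x g = ∀ p → T (collinear x p) → pf g p ≡ p

  record SymGroup (t : ℕ) (x : Pt) (H : Aut → Set) (𝕊 : Fin t → Aut) : Set where
    field
      distinct : ∀ i j → 𝕊 i ≈A 𝕊 j → i ≡ j
      inH      : ∀ i → H (𝕊 i)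
      isSym    : ∀ i → IsSymmetry x (𝕊 i)
      hasId    : Σ (Fin t) (λ i → IsId (𝕊 i))
      closed   : ∀ i j → Σ (Fin t) (λ k → IsComp (𝕊 k) (𝕊 i) (𝕊 j))
      invs     : ∀ i → Σ (Fin t) (λ k → Σ Aut (λ e → IsId e × IsComp e (𝕊 k) (𝕊 i)))

  record IsSTGQ (s t : ℕ) (x : Pt) (H : Aut → Set) (𝕊 : Fin t → Aut) : Set where
    field
      egq  : IsEGQ s t x H
      symg : SymGroup t x H 𝕊

  PropertyStar : Pt → (Aut → Set) → Set
  PropertyStar x H = ∀ h → H h → ∀ y → y ≢ x → T (collinear x y) →
                     pf h y ≡ y →
                     ∀ L → T (I x L) → T (I y L) → ∀ z → T (I z L) → pf h z ≡ z

  Commute : Aut → Aut → Set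
  Commute g h = (∀ p → pf g (pf h p) ≡ pf h (pf g p))
              × (∀ L → lf g (lf h L) ≡ lf h (lf g L))

  Central : (t : ℕ) → (Aut → Set) → (Fin t → Aut) → Set
  Central t H 𝕊 = ∀ i h → H h → Commute (𝕊 i) h

{-# OPTIONS --safe #-}

-- For a line L_i on x let u_i be its point collinear with a fixed z opposite x, let M_i be the line z u_i,
-- and let P_i, Q_i be the stabilisers of u_i and M_i in H.  By (*) the P_i are normal, so commutators of
-- elements of P_i and P_j (i ≠ j) lie in P_i ∩ P_j = 𝕊; with a third index the Q_i turn out to be abelian.
-- In a quadrangle of order (t², t) every three pairwise disjoint lines have exactly t + 1 transversals.
-- Applied to L_i, M_j and the image of M_j under b y (1 ≠ b ∈ Q_i, y ∈ 𝕊) this yields 1 ≠ a ∈ Q_j with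
-- y = [b⁻¹, a].  For y = 1 it says that every a ∈ Q_j commutes with some b ≠ 1 in Q_i; hence a commutes
-- with all the commutators [b⁻¹, a′], a′ ∈ Q_j, that is, with all of 𝕊.  As the Q_i and 𝕊 generate H,
-- 𝕊 is central.

module Submission where

open import Defs
open import Data.Nat using (ℕ; zero; suc; _≥_; _*_; z≤n; s≤s)
import Data.Nat.Properties as ℕₚ
open import Data.Fin using (Fin; zero; suc)
open import Data.Fin.Properties using (_≟_; any?; suc-injective; pigeonhole; <⇒≢)
open import Data.Integer using (ℤ; +_; -[1+_]; +≤+; 0ℤ; 1ℤ)
  renaming (_+_ to _⊕_; _*_ to _⊗_; -_ to ⊖_; _≤_ to _≤ᶻ_)
import Data.Integer.Properties as ℤₚ
open import Data.Integer.Tactic.RingSolver using (solve-∀)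
open import Data.Bool using (Bool; true; false; _∧_; T; if_then_else_)
open import Data.Bool.Properties using (T-∧; T?)
open import Data.Product using (Σ; ∃; ∃₂; _×_; _,_; proj₁; proj₂)
open import Data.Sum using (inj₁; [_,_]′)
open import Data.Empty using (⊥; ⊥-elim)
open import Data.Unit using (tt)
open import Function using (case_of_)
open import Function.Bundles using (Equivalence)
open import Relation.Nullary using (¬_; Dec; yes; no; contradiction)
open import Relation.Nullary.Decidable using (decidable-stable; _×-dec_; ¬?)
open import Relation.Binary.PropositionalEquality
  using (_≡_; _≢_; refl; sym; trans; cong; cong₂; subst; subst₂; ≢-sym; module ≡-Reasoning)
open import Algebra.Bundles using (Group)
import Algebra.Properties.Group as GroupProperties
open import Level using (0ℓ)
open import Algebra.Properties.Semiring.Sum ℤₚ.+-*-semiring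
  using (sum; sum-cong-≗; ∑-distrib-+; ∑-comm; *-distribˡ-sum; *-distribʳ-sum)

-- Property (*) enters only in the normality of the `P_i`: it makes the stabiliser of the single
-- point `u_i` the kernel of the action of H on the points of `L_i`. Normality puts the commutators
-- into 𝕊; the difficulty is that they must also fill 𝕊, and this is what the order (t², t) is for.
-- A transversal `a M_i` of the three lines amounts to an equation `h a′ = a b′` with `h = b y`,
-- which becomes a commutator formula once it is read modulo `P_i` and modulo `P_j`.
--
-- The count of transversals is dual to the count of centres of a triad of points in order (s, s²).
-- The matrix `C = BᵀB` has the eigenvalues (s + 1)(t + 1), s + t and 0, and the vector `v` below is
-- -(s + t) times the component of `w` in the kernel. A vanishing sum of integer squares replaces
-- the decomposition into eigenspaces.

-- Counting the true values of Boolean predicates on `Fin n`.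

T-intro : ∀ {a b} → T a → T b → T (a ∧ b)
T-intro p q = Equivalence.from T-∧ (p , q)

T-elim : ∀ {a b} → T (a ∧ b) → T a × T b
T-elim = Equivalence.to T-∧

anyFin-intro : ∀ {n} (f : Fin n → Bool) i → T (f i) → T (anyFin n f)
anyFin-intro f zero p with f zero
... | true = tt
anyFin-intro f (suc i) p with f zero
... | true = tt
... | false = anyFin-intro (λ j → f (suc j)) i p

anyFin-elim : ∀ {n} (f : Fin n → Bool) → T (anyFin n f) → ∃ λ i → T (f i)
anyFin-elim {suc n} f p with f zero in eq
... | true = zero , subst T (sym eq) tt
... | false with anyFin-elim (λ j → f (suc j)) p
...   | i , q = suc i , q

count-none : ∀ {n} (f : Fin n → Bool) → (∀ i → ¬ T (f i)) → count n f ≡ 0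
count-none {zero} f h = refl
count-none {suc n} f h with f zero | h zero
... | true | h₀ = contradiction tt h₀
... | false | _ = count-none (λ i → f (suc i)) (λ i → h (suc i))

count-some : ∀ {n k} (f : Fin n → Bool) → count n f ≡ suc k → ∃ λ i → T (f i)
count-some f eq with any? (λ i → T? (f i))
... | yes p = p
... | no ¬p = case trans (sym eq) (count-none f (λ i q → ¬p (i , q))) of λ ()

enum : ∀ {n} (f : Fin n → Bool) → Fin (count n f) → Fin n
enum {suc n} f i with f zero
enum {suc n} f zero    | true  = zero
enum {suc n} f (suc i) | true  = suc (enum (λ j → f (suc j)) i)
enum {suc n} f i       | false = suc (enum (λ j → f (suc j)) i)

enum-true : ∀ {n} (f : Fin n → Bool) i → T (f (enum f i))
enum-true {suc n} f i with f zero in eq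
enum-true {suc n} f zero    | true  = subst T (sym eq) tt
enum-true {suc n} f (suc i) | true  = enum-true (λ j → f (suc j)) i
enum-true {suc n} f i       | false = enum-true (λ j → f (suc j)) i

enum-injective : ∀ {n} (f : Fin n → Bool) {i j} → enum f i ≡ enum f j → i ≡ j
enum-injective {suc n} f {i} {j} eq with f zero
enum-injective {suc n} f {zero}  {zero}  eq | true = refl
enum-injective {suc n} f {suc i} {suc j} eq | true =
  cong suc (enum-injective (λ k → f (suc k)) (suc-injective eq))
enum-injective {suc n} f {i} {j} eq | false = enum-injective (λ k → f (suc k)) (suc-injective eq)

enum-surjective : ∀ {n} (f : Fin n → Bool) j → T (f j) → ∃ λ i → enum f i ≡ j
enum-surjective {suc n} f j p with f zero in eq
enum-surjective {suc n} f zero p | true = zero , refl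
enum-surjective {suc n} f zero p | false = ⊥-elim (subst T eq p)
enum-surjective {suc n} f (suc j) p | true with enum-surjective (λ k → f (suc k)) j p
... | i , q = suc i , cong suc q
enum-surjective {suc n} f (suc j) p | false with enum-surjective (λ k → f (suc k)) j p
... | i , q = i , cong suc q

count-unique : ∀ {n} (f : Fin n → Bool) → count n f ≡ 1 → ∀ {i j} → T (f i) → T (f j) → i ≡ j
count-unique f eq {i} {j} p q
  with enum-surjective f i p | enum-surjective f j q
... | a , refl | b , refl = cong (enum f) (all-equal eq a b)
  where
  all-equal : ∀ {m} → m ≡ 1 → (a b : Fin m) → a ≡ b
  all-equal refl zero zero = refl

-- If every true index were `i` or `j`, equality with `i` would separate the true indices by two
-- colours, against the pigeonhole principle. `i` and `j` may coincide.
count-avoid : ∀ {n} (f : Fin n → Bool) → count n f ≥ 3 →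
              ∀ i j → ∃ λ k → T (f k) × k ≢ i × k ≢ j
count-avoid {n} f c≥3 i j
  with any? (λ k → T? (f k) ×-dec (¬? (k ≟ i) ×-dec ¬? (k ≟ j)))
... | yes p = p
... | no ¬p = ⊥-elim absurd
  where
  colour : Fin n → Fin 2
  colour k with k ≟ i
  ... | yes _ = zero
  ... | no _  = suc zero
  onto : ∀ {m} → T (f m) → m ≢ i → m ≡ j
  onto {m} u v = decidable-stable (m ≟ j) (λ w → ¬p (m , u , v , w))
  same : ∀ k l → T (f k) → T (f l) → colour k ≡ colour l → k ≡ l
  same k l p q e with k ≟ i | l ≟ i
  same k l p q e  | yes r | yes s = trans r (sym s)
  same k l p q e  | no r  | no s  = trans (onto p r) (sym (onto q s))
  same k l p q () | yes _ | no _
  same k l p q () | no _  | yes _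
  absurd : ⊥
  absurd with pigeonhole c≥3 (λ a → colour (enum f a))
  ... | a , b , a<b , eq =
    <⇒≢ a<b (enum-injective f (same (enum f a) (enum f b) (enum-true f a) (enum-true f b) eq))

-- An index missed by `e` could be adjoined to it, giving one more distinct true index than there
-- are.
injective⇒onto : ∀ {n k} (f : Fin n → Bool) → count n f ≡ k → (e : Fin k → Fin n) →
                 (∀ {a b} → e a ≡ e b → a ≡ b) → (∀ a → T (f (e a))) →
                 ∀ j → T (f j) → ∃ λ a → e a ≡ j
injective⇒onto {n} f refl e e-inj e-true j p with any? (λ a → e a ≟ j)
... | yes q = q
... | no ¬q = ⊥-elim absurd
  where
  e⁺ : Fin (suc (count n f)) → Fin n
  e⁺ zero = j
  e⁺ (suc a) = e a
  e⁺-true : ∀ a → T (f (e⁺ a))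
  e⁺-true zero = p
  e⁺-true (suc a) = e-true a
  e⁺-inj : ∀ a b → e⁺ a ≡ e⁺ b → a ≡ b
  e⁺-inj zero zero _ = refl
  e⁺-inj zero (suc b) r = ⊥-elim (¬q (b , sym r))
  e⁺-inj (suc a) zero r = ⊥-elim (¬q (a , r))
  e⁺-inj (suc a) (suc b) r = cong suc (e-inj r)
  index : ∀ a → ∃ λ i → enum f i ≡ e⁺ a
  index a = enum-surjective f (e⁺ a) (e⁺-true a)
  absurd : ⊥
  absurd with pigeonhole (ℕₚ.n<1+n _) (λ a → proj₁ (index a))
  ... | a , b , a<b , eq = <⇒≢ a<b (e⁺-inj a b
    (trans (sym (proj₂ (index a))) (trans (cong (enum f) eq) (proj₂ (index b)))))

-- Integer sums

⟦_⟧ : Bool → ℤ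
⟦ b ⟧ = if b then 1ℤ else 0ℤ

opaque
  δ : ∀ {n} → Fin n → Fin n → ℤ
  δ i j with i ≟ j
  ... | yes _ = 1ℤ
  ... | no _  = 0ℤ

  δ-refl : ∀ {n} (i : Fin n) → δ i i ≡ 1ℤ
  δ-refl i with i ≟ i
  ... | yes _ = refl
  ... | no i≢i = contradiction refl i≢i

  δ-≢ : ∀ {n} {i j : Fin n} → i ≢ j → δ i j ≡ 0ℤ
  δ-≢ {i = i} {j} i≢j with i ≟ j
  ... | yes p = contradiction p i≢j
  ... | no _ = refl

T⇒≡true : ∀ {b} → T b → b ≡ true
T⇒≡true {true} _ = refl

¬T⇒≡false : ∀ {b} → ¬ T b → b ≡ false
¬T⇒≡false {false} _ = refl
¬T⇒≡false {true} h = contradiction tt h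

⟦⟧-true : ∀ {b} → T b → ⟦ b ⟧ ≡ 1ℤ
⟦⟧-true p = cong ⟦_⟧ (T⇒≡true p)

⟦⟧-false : ∀ {b} → ¬ T b → ⟦ b ⟧ ≡ 0ℤ
⟦⟧-false p = cong ⟦_⟧ (¬T⇒≡false p)

⟦⟧-∧ : ∀ a b → ⟦ a ∧ b ⟧ ≡ ⟦ a ⟧ ⊗ ⟦ b ⟧
⟦⟧-∧ true true = refl
⟦⟧-∧ true false = refl
⟦⟧-∧ false b = refl

sum-zero : ∀ {n} (f : Fin n → ℤ) → (∀ i → f i ≡ 0ℤ) → sum f ≡ 0ℤ
sum-zero {zero} f h = refl
sum-zero {suc n} f h = cong₂ _⊕_ (h zero) (sum-zero (λ i → f (suc i)) (λ i → h (suc i)))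

sum-single : ∀ {n} (f : Fin n → ℤ) i → (∀ j → j ≢ i → f j ≡ 0ℤ) → sum f ≡ f i
sum-single {suc n} f zero h =
  trans (cong (f zero ⊕_) (sum-zero (λ j → f (suc j)) (λ j → h (suc j) λ ()))) (ℤₚ.+-identityʳ _)
sum-single {suc n} f (suc i) h =
  trans (cong₂ _⊕_ (h zero (λ ()))
           (sum-single (λ j → f (suc j)) i (λ j ne → h (suc j) (λ e → ne (suc-injective e)))))
        (ℤₚ.+-identityˡ _)

sum-δ : ∀ {n} (f : Fin n → ℤ) i → sum (λ j → f j ⊗ δ j i) ≡ f i
sum-δ f i = trans (sum-single (λ j → f j ⊗ δ j i) i
                    (λ j ne → trans (cong (f j ⊗_) (δ-≢ ne)) (ℤₚ.*-zeroʳ (f j))))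
                  (trans (cong (f i ⊗_) (δ-refl i)) (ℤₚ.*-identityʳ (f i)))

sum-count : ∀ {n} (f : Fin n → Bool) → sum (λ i → ⟦ f i ⟧) ≡ + count n f
sum-count {zero} f = refl
sum-count {suc n} f with f zero
... | true  = cong (1ℤ ⊕_) (sum-count (λ i → f (suc i)))
... | false = trans (ℤₚ.+-identityˡ _) (sum-count (λ i → f (suc i)))

sum-atMostOne : ∀ {n} (f : Fin n → Bool) → (∀ i j → T (f i) → T (f j) → i ≡ j) →
                sum (λ i → ⟦ f i ⟧) ≡ ⟦ anyFin n f ⟧
sum-atMostOne {n} f h with T? (anyFin n f)
... | yes p = let i , q = anyFin-elim f p in
      trans (sum-single (λ i → ⟦ f i ⟧) i (λ j ne → ⟦⟧-false (λ r → ne (h j i r q))))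
            (trans (⟦⟧-true q) (sym (⟦⟧-true p)))
... | no ¬p = trans (sum-zero _ (λ i → ⟦⟧-false (λ q → ¬p (anyFin-intro f i q)))) (sym (⟦⟧-false ¬p))

-- Associativity of a row vector, a matrix and a column vector; it serves to move `B` across scalar
-- products.
sum-assoc : ∀ {m n} (g : Fin m → ℤ) (M : Fin m → Fin n → ℤ) (f : Fin n → ℤ) →
            sum (λ i → g i ⊗ sum (λ j → M i j ⊗ f j)) ≡ sum (λ j → sum (λ i → g i ⊗ M i j) ⊗ f j)
sum-assoc {m} {n} g M f = begin
  sum (λ i → g i ⊗ sum (λ j → M i j ⊗ f j))
    ≡⟨ sum-cong-≗ (λ i → *-distribˡ-sum (g i) (λ j → M i j ⊗ f j)) ⟩
  sum (λ i → sum (λ j → g i ⊗ (M i j ⊗ f j)))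
    ≡⟨ ∑-comm (λ i j → g i ⊗ (M i j ⊗ f j)) ⟩
  sum (λ j → sum (λ i → g i ⊗ (M i j ⊗ f j)))
    ≡⟨ sum-cong-≗ (λ j → sum-cong-≗ (λ i → sym (ℤₚ.*-assoc (g i) (M i j) (f j)))) ⟩
  sum (λ j → sum (λ i → (g i ⊗ M i j) ⊗ f j))
    ≡⟨ sum-cong-≗ (λ j → sym (*-distribʳ-sum (f j) (λ i → g i ⊗ M i j))) ⟩
  sum (λ j → sum (λ i → g i ⊗ M i j) ⊗ f j) ∎
  where open ≡-Reasoning

sum-linear : ∀ {n} (a b : ℤ) (f g : Fin n → ℤ) →
             sum (λ i → a ⊗ f i ⊕ b ⊗ g i) ≡ a ⊗ sum f ⊕ b ⊗ sum g
sum-linear a b f g = trans (∑-distrib-+ (λ i → a ⊗ f i) (λ i → b ⊗ g i))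
  (cong₂ _⊕_ (sym (*-distribˡ-sum a f)) (sym (*-distribˡ-sum b g)))

square-nonneg : ∀ i → 0ℤ ≤ᶻ i ⊗ i
square-nonneg (+ n) = subst (0ℤ ≤ᶻ_) (ℤₚ.pos-* n n) (+≤+ z≤n)
square-nonneg -[1+ n ] = +≤+ z≤n

sum-nonneg : ∀ {n} (f : Fin n → ℤ) → (∀ i → 0ℤ ≤ᶻ f i) → 0ℤ ≤ᶻ sum f
sum-nonneg {zero} f h = ℤₚ.≤-refl
sum-nonneg {suc n} f h = ℤₚ.+-mono-≤ (h zero) (sum-nonneg (λ i → f (suc i)) (λ i → h (suc i)))

nonneg-sum-zero : ∀ {a b} → 0ℤ ≤ᶻ a → 0ℤ ≤ᶻ b → a ⊕ b ≡ 0ℤ → a ≡ 0ℤ × b ≡ 0ℤ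
nonneg-sum-zero {a} {b} 0≤a 0≤b eq =
  ℤₚ.≤-antisym (subst₂ _≤ᶻ_ (ℤₚ.+-identityʳ a) eq (ℤₚ.+-monoʳ-≤ a 0≤b)) 0≤a ,
  ℤₚ.≤-antisym (subst₂ _≤ᶻ_ (ℤₚ.+-identityˡ b) eq (ℤₚ.+-monoˡ-≤ b 0≤a)) 0≤b

sum-squares-zero : ∀ {n} (f : Fin n → ℤ) → sum (λ i → f i ⊗ f i) ≡ 0ℤ → ∀ i → f i ≡ 0ℤ
sum-squares-zero {suc n} f eq i
  with nonneg-sum-zero (square-nonneg (f zero))
         (sum-nonneg (λ j → f (suc j) ⊗ f (suc j)) (λ j → square-nonneg (f (suc j)))) eq
sum-squares-zero {suc n} f eq zero | p , _ = [ (λ e → e) , (λ e → e) ]′ (ℤₚ.i*j≡0⇒i≡0∨j≡0 (f zero) p)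
sum-squares-zero {suc n} f eq (suc i) | _ , q = sum-squares-zero (λ j → f (suc j)) q i

-- Generalized quadrangles

module GQ (S : IncStr) (s t : ℕ) (gq : IsGQ S s t) where
  open IncStr S using (np; nl; I)
  open IsGQ gq

  infix 4 _on_ _meets_ _~_

  _on_ : Pt S → Ln S → Set
  p on L = T (I p L)

  meet? : Ln S → Ln S → Bool
  meet? L M = anyFin np (λ p → I p L ∧ I p M)

  _meets_ : Ln S → Ln S → Set
  L meets M = ∃ λ p → p on L × p on M

  _~_ : Pt S → Pt S → Set
  p ~ q = T (collinear S p q)

  ~-intro : ∀ {p q L} → p on L → q on L → p ~ q
  ~-intro {p} {q} {L} pL qL = anyFin-intro (λ M → I p M ∧ I q M) L (T-intro pL qL)

  ~-elim : ∀ {p q} → p ~ q → ∃ λ L → p on L × q on L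
  ~-elim pq with anyFin-elim _ pq
  ... | L , h = L , T-elim h

  meet?-intro : ∀ {L M} → L meets M → T (meet? L M)
  meet?-intro {L} {M} (p , pL , pM) = anyFin-intro (λ q → I q L ∧ I q M) p (T-intro pL pM)

  meet?-elim : ∀ {L M} → T (meet? L M) → L meets M
  meet?-elim h with anyFin-elim _ h
  ... | p , k = p , T-elim k

  meets-sym : ∀ {L M} → L meets M → M meets L
  meets-sym (p , pL , pM) = p , pM , pL

  line-unique : ∀ {p q L M} → p on L → q on L → p on M → q on M → p ≢ q → L ≡ M
  line-unique pL qL pM qM p≢q = partialLin _ _ _ _ pL qL pM qM p≢q

  point-unique : ∀ {p q L M} → L ≢ M → p on L → p on M → q on L → q on M → p ≡ q
  point-unique {p} {q} L≢M pL pM qL qM =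
    decidable-stable (p ≟ q) (λ p≢q → L≢M (line-unique pL qL pM qM p≢q))

  project : ∀ {p L} → ¬ p on L → ∃ λ q → q on L × p ~ q
  project {p} {L} p∉L with count-some _ (gqAxiom p L p∉L)
  ... | q , h = q , T-elim h

  project-unique : ∀ {p L q r} → ¬ p on L → q on L → p ~ q → r on L → p ~ r → q ≡ r
  project-unique {p} {L} p∉L qL pq rL pr =
    count-unique _ (gqAxiom p L p∉L) (T-intro qL pq) (T-intro rL pr)

  -- Otherwise `q` and `r` are both the projection of `p` to `N`, so they coincide, and then they
  -- equal `p`. Only `L ≢ M` is assumed, so degenerate triangles are covered as well.
  no-triangle : ∀ {L M N p q r} → L ≢ M → p on L → p on M → q on M → q on N → r on N → r on L → p on N
  no-triangle {L} {M} {N} {p} {q} {r} L≢M pL pM qM qN rN rL =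
    decidable-stable (T? (I p N)) λ p∉N →
      let q≡r = project-unique p∉N qN (~-intro pM qM) rN (~-intro pL rL)
          p≡q = point-unique L≢M pL pM (subst (_on L) (sym q≡r) rL) qM
      in p∉N (subst (_on N) (sym p≡q) qN)

  -- The incidence matrix `B`, with `C = BᵀB` on lines and `J = BBᵀ` on points.

  B : Pt S → Ln S → ℤ
  B p L = ⟦ I p L ⟧

  C : Ln S → Ln S → ℤ
  C L M = sum (λ p → B p L ⊗ B p M)

  J : Pt S → Pt S → ℤ
  J p q = sum (λ L → B p L ⊗ B q L)

  C-sym : ∀ L M → C L M ≡ C M L
  C-sym L M = sum-cong-≗ (λ p → ℤₚ.*-comm (B p L) (B p M))

  C-≢ : ∀ {L M} → L ≢ M → C L M ≡ ⟦ meet? L M ⟧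
  C-≢ {L} {M} L≢M = trans (sum-cong-≗ (λ p → sym (⟦⟧-∧ (I p L) (I p M))))
    (sum-atMostOne (λ p → I p L ∧ I p M) (λ p q hp hq →
      point-unique L≢M (proj₁ (T-elim hp)) (proj₂ (T-elim hp)) (proj₁ (T-elim hq)) (proj₂ (T-elim hq))))

  J-≢ : ∀ {p q} → p ≢ q → J p q ≡ ⟦ collinear S p q ⟧
  J-≢ {p} {q} p≢q = trans (sum-cong-≗ (λ L → sym (⟦⟧-∧ (I p L) (I q L))))
    (sum-atMostOne (λ L → I p L ∧ I q L) (λ L M hL hM →
      line-unique (proj₁ (T-elim hL)) (proj₂ (T-elim hL)) (proj₁ (T-elim hM)) (proj₂ (T-elim hM)) p≢q))

  ⟦⟧-idem : ∀ b → ⟦ b ⟧ ⊗ ⟦ b ⟧ ≡ ⟦ b ⟧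
  ⟦⟧-idem true = refl
  ⟦⟧-idem false = refl

  -- Opaque, because integer products of literals + s and + t would be unfolded in every comparison.
  opaque
    σ τ : ℤ
    σ = + s
    τ = + t

    +s≡σ : + s ≡ σ
    +s≡σ = refl

    +t≡τ : + t ≡ τ
    +t≡τ = refl

    1+σ-cancel : ∀ i → i ⊗ (1ℤ ⊕ σ) ≡ 0ℤ → i ≡ 0ℤ
    1+σ-cancel i eq with ℤₚ.i*j≡0⇒i≡0∨j≡0 i eq
    -- The other alternative, 1 + s = 0, is refuted by the form `+ suc s`, visible once `σ` unfolds.
    ... | inj₁ e = e

  B-row : ∀ p → sum (B p) ≡ 1ℤ ⊕ τ
  B-row p = trans (sum-count (I p)) (trans (cong +_ (ptLines p)) (cong (1ℤ ⊕_) +t≡τ))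

  B-column : ∀ L → sum (λ p → B p L) ≡ 1ℤ ⊕ σ
  B-column L = trans (sum-count (λ p → I p L)) (trans (cong +_ (linePts L)) (cong (1ℤ ⊕_) +s≡σ))

  C-refl : ∀ L → C L L ≡ 1ℤ ⊕ σ
  C-refl L = trans (sum-cong-≗ (λ p → ⟦⟧-idem (I p L))) (B-column L)

  J-refl : ∀ p → J p p ≡ 1ℤ ⊕ τ
  J-refl p = trans (sum-cong-≗ (λ L → ⟦⟧-idem (I p L))) (B-row p)

  C-meets : ∀ {L M} → L ≢ M → L meets M → C L M ≡ 1ℤ
  C-meets L≢M m = trans (C-≢ L≢M) (⟦⟧-true (meet?-intro m))

  C-disjoint : ∀ {L M} → ¬ L meets M → C L M ≡ 0ℤ
  C-disjoint {L} {M} d = sum-zero (λ p → B p L ⊗ B p M) (λ p →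
    trans (sym (⟦⟧-∧ (I p L) (I p M))) (⟦⟧-false (λ h → d (p , T-elim h))))

  -- The quadrangle axiom as the matrix identity B Bᵀ B = (s + t) B + 1, with 1 the all-one matrix.
  BBᵀB : ∀ p L → sum (λ q → J p q ⊗ B q L) ≡ (σ ⊕ τ) ⊗ B p L ⊕ 1ℤ
  BBᵀB p L with T? (I p L)
  ... | yes pL = begin
    sum (λ q → J p q ⊗ B q L)                          ≡⟨ sum-cong-≗ term ⟩
    sum (λ q → B q L ⊕ τ ⊗ δ q p)                      ≡⟨ ∑-distrib-+ (λ q → B q L) (λ q → τ ⊗ δ q p) ⟩
    sum (λ q → B q L) ⊕ sum (λ q → τ ⊗ δ q p)          ≡⟨ cong₂ _⊕_ (B-column L) (sum-δ (λ _ → τ) p) ⟩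
    (1ℤ ⊕ σ) ⊕ τ                                      ≡⟨ arith σ τ ⟩
    (σ ⊕ τ) ⊗ 1ℤ ⊕ 1ℤ                                  ≡⟨ cong (λ b → (σ ⊕ τ) ⊗ b ⊕ 1ℤ) (sym (⟦⟧-true pL)) ⟩
    (σ ⊕ τ) ⊗ B p L ⊕ 1ℤ                               ∎
    where
    open ≡-Reasoning
    arith : ∀ a b → (1ℤ ⊕ a) ⊕ b ≡ (a ⊕ b) ⊗ 1ℤ ⊕ 1ℤ
    arith = solve-∀
    arith₁ : ∀ b → (1ℤ ⊕ b) ⊗ 1ℤ ≡ 1ℤ ⊕ b ⊗ 1ℤ
    arith₁ = solve-∀
    arith₂ : ∀ a b → a ≡ a ⊕ b ⊗ 0ℤ
    arith₂ = solve-∀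
    -- On `L` the row of `J` at `p` is 1 at every point, with an additional `τ` at `p` itself.
    term : ∀ q → J p q ⊗ B q L ≡ B q L ⊕ τ ⊗ δ q p
    term q with q ≟ p
    ... | yes refl = trans (cong₂ _⊗_ (J-refl q) (⟦⟧-true pL))
                       (trans (arith₁ τ) (cong₂ (λ a b → a ⊕ τ ⊗ b) (sym (⟦⟧-true pL)) (sym (δ-refl q))))
    ... | no q≢p with T? (I q L)
    ...   | yes qL = trans (cong (_⊗ B q L) (trans (J-≢ (≢-sym q≢p)) (⟦⟧-true (~-intro pL qL))))
                       (trans (ℤₚ.*-identityˡ _) (trans (arith₂ (B q L) τ) (cong (λ b → B q L ⊕ τ ⊗ b) (sym (δ-≢ q≢p)))))
    ...   | no q∉L = trans (cong (J p q ⊗_) (⟦⟧-false q∉L))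
                       (trans (ℤₚ.*-zeroʳ (J p q)) (trans (arith₂ 0ℤ τ) (cong₂ (λ a b → a ⊕ τ ⊗ b) (sym (⟦⟧-false q∉L)) (sym (δ-≢ q≢p)))))
  BBᵀB p L | no p∉L = begin
    sum (λ q → J p q ⊗ B q L)                ≡⟨ sum-cong-≗ term ⟩
    sum (λ q → ⟦ I q L ∧ collinear S p q ⟧)  ≡⟨ sum-count (λ q → I q L ∧ collinear S p q) ⟩
    + count np (λ q → I q L ∧ collinear S p q) ≡⟨ cong +_ (gqAxiom p L p∉L) ⟩
    1ℤ                                       ≡⟨ arith (σ ⊕ τ) ⟩
    (σ ⊕ τ) ⊗ 0ℤ ⊕ 1ℤ                        ≡⟨ cong (λ b → (σ ⊕ τ) ⊗ b ⊕ 1ℤ) (sym (⟦⟧-false p∉L)) ⟩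
    (σ ⊕ τ) ⊗ B p L ⊕ 1ℤ                     ∎
    where
    open ≡-Reasoning
    arith : ∀ a → 1ℤ ≡ a ⊗ 0ℤ ⊕ 1ℤ
    arith = solve-∀
    term : ∀ q → J p q ⊗ B q L ≡ ⟦ I q L ∧ collinear S p q ⟧
    term q with T? (I q L)
    ... | yes qL = trans (cong (_⊗ B q L) (J-≢ (λ p≡q → p∉L (subst (_on L) (sym p≡q) qL))))
                     (trans (ℤₚ.*-comm ⟦ collinear S p q ⟧ (B q L)) (sym (⟦⟧-∧ (I q L) (collinear S p q))))
    ... | no q∉L = trans (cong (J p q ⊗_) (⟦⟧-false q∉L))
                     (trans (ℤₚ.*-zeroʳ (J p q)) (sym (⟦⟧-false (λ h → q∉L (proj₁ (T-elim h))))))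

  BC : ∀ p T → sum (λ N → B p N ⊗ C N T) ≡ (σ ⊕ τ) ⊗ B p T ⊕ 1ℤ
  BC p T = trans (sum-assoc (B p) (λ N q → B q N) (λ q → B q T)) (BBᵀB p T)

  -- Let w be the indicator of the transversals of the disjoint lines L and M plus t (e_L + e_M), and
  -- v = (C - (s + t)) w - (t + 1).  Then B v = 0 by the matrix identity above, and v vanishes on the
  -- support of w by inspection.  As v is a combination
  -- of w and of the vectors C w and 1, which lie in the row space of B, v · v = 0 and so v = 0.
  module Transversals (s≡t² : s ≡ t * t) {L M : Ln S} (L∦M : ¬ L meets M) where

    σ≡τ² : σ ≡ τ ⊗ τ
    σ≡τ² = trans (sym +s≡σ) (trans (cong +_ s≡t²) (trans (ℤₚ.pos-* t t) (cong₂ _⊗_ +t≡τ +t≡τ)))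

    L≢M : L ≢ M
    L≢M refl with count-some (λ p → I p L) (linePts L)
    ... | p , pL = L∦M (p , pL , pL)

    -- The weight t on `L` and `M` is forced: with a weight c instead, `v` would be 2(c - t) at a
    -- transversal.
    w Cw v : Ln S → ℤ
    w T = C T L ⊗ C T M ⊕ τ ⊗ (δ T L ⊕ δ T M)
    Cw N = sum (λ T → C N T ⊗ w T)
    v N = Cw N ⊕ (⊖ (σ ⊕ τ)) ⊗ w N ⊕ (⊖ (1ℤ ⊕ τ))

    sum-δδ : ∀ (f : Ln S → ℤ) → sum (λ T → f T ⊗ (τ ⊗ (δ T L ⊕ δ T M))) ≡ τ ⊗ (f L ⊕ f M)
    sum-δδ f = begin
      sum (λ T → f T ⊗ (τ ⊗ (δ T L ⊕ δ T M)))
        ≡⟨ sum-cong-≗ (λ T → distribute (f T) τ (δ T L) (δ T M)) ⟩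
      sum (λ T → τ ⊗ (f T ⊗ δ T L) ⊕ τ ⊗ (f T ⊗ δ T M))
        ≡⟨ sum-linear τ τ (λ T → f T ⊗ δ T L) (λ T → f T ⊗ δ T M) ⟩
      τ ⊗ sum (λ T → f T ⊗ δ T L) ⊕ τ ⊗ sum (λ T → f T ⊗ δ T M)
        ≡⟨ cong₂ (λ a b → τ ⊗ a ⊕ τ ⊗ b) (sum-δ f L) (sum-δ f M) ⟩
      τ ⊗ f L ⊕ τ ⊗ f M
        ≡⟨ sym (ℤₚ.*-distribˡ-+ τ (f L) (f M)) ⟩
      τ ⊗ (f L ⊕ f M) ∎
      where
      open ≡-Reasoning
      distribute : ∀ a b c d → a ⊗ (b ⊗ (c ⊕ d)) ≡ b ⊗ (a ⊗ c) ⊕ b ⊗ (a ⊗ d)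
      distribute = solve-∀

    Cw-split : ∀ N → Cw N ≡ sum (λ T → C N T ⊗ (C T L ⊗ C T M)) ⊕ τ ⊗ (C N L ⊕ C N M)
    Cw-split N = begin
      Cw N
        ≡⟨ sum-cong-≗ (λ T → ℤₚ.*-distribˡ-+ (C N T) (C T L ⊗ C T M) (τ ⊗ (δ T L ⊕ δ T M))) ⟩
      sum (λ T → C N T ⊗ (C T L ⊗ C T M) ⊕ C N T ⊗ (τ ⊗ (δ T L ⊕ δ T M)))
        ≡⟨ ∑-distrib-+ (λ T → C N T ⊗ (C T L ⊗ C T M)) (λ T → C N T ⊗ (τ ⊗ (δ T L ⊕ δ T M))) ⟩
      sum (λ T → C N T ⊗ (C T L ⊗ C T M)) ⊕ sum (λ T → C N T ⊗ (τ ⊗ (δ T L ⊕ δ T M)))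
        ≡⟨ cong (sum (λ T → C N T ⊗ (C T L ⊗ C T M)) ⊕_) (sum-δδ (C N)) ⟩
      sum (λ T → C N T ⊗ (C T L ⊗ C T M)) ⊕ τ ⊗ (C N L ⊕ C N M) ∎
      where open ≡-Reasoning

    -- Each of the s + 1 points of `L` lies on exactly one line meeting `M`; the count is read off
    -- from the entry of `C · C` at `L` and `M`.
    sum-CC : sum (λ T → C T L ⊗ C T M) ≡ (1ℤ ⊕ σ)
    sum-CC = begin
      sum (λ T → C T L ⊗ C T M)
        ≡⟨ sum-cong-≗ (λ T → cong (_⊗ C T M) (C-sym T L)) ⟩
      sum (λ T → C L T ⊗ C T M)
        ≡⟨ sym (sum-assoc (λ p → B p L) B (λ T → C T M)) ⟩
      sum (λ p → B p L ⊗ sum (λ T → B p T ⊗ C T M))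
        ≡⟨ sum-cong-≗ (λ p → trans (cong (B p L ⊗_) (BC p M)) (distribute (B p L) (σ ⊕ τ) (B p M))) ⟩
      sum (λ p → (σ ⊕ τ) ⊗ (B p L ⊗ B p M) ⊕ 1ℤ ⊗ B p L)
        ≡⟨ sum-linear (σ ⊕ τ) 1ℤ (λ p → B p L ⊗ B p M) (λ p → B p L) ⟩
      (σ ⊕ τ) ⊗ C L M ⊕ 1ℤ ⊗ sum (λ p → B p L)
        ≡⟨ cong₂ (λ a b → (σ ⊕ τ) ⊗ a ⊕ 1ℤ ⊗ b) (C-disjoint L∦M) (B-column L) ⟩
      (σ ⊕ τ) ⊗ 0ℤ ⊕ 1ℤ ⊗ (1ℤ ⊕ σ)
        ≡⟨ simplify (σ ⊕ τ) ((1ℤ ⊕ σ)) ⟩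
      (1ℤ ⊕ σ) ∎
      where
      open ≡-Reasoning
      distribute : ∀ a b c → a ⊗ (b ⊗ c ⊕ 1ℤ) ≡ b ⊗ (a ⊗ c) ⊕ 1ℤ ⊗ a
      distribute = solve-∀
      simplify : ∀ a b → a ⊗ 0ℤ ⊕ 1ℤ ⊗ b ≡ b
      simplify = solve-∀

    -- Because s = t², the total (1 + s) + 2t is the square of the row sum 1 + t of `B`; this makes
    -- the constants cancel in `Bv≡0`.
    sum-w : sum w ≡ (1ℤ ⊕ τ) ⊗ (1ℤ ⊕ τ)
    sum-w = begin
      sum w
        ≡⟨ ∑-distrib-+ (λ T → C T L ⊗ C T M) (λ T → τ ⊗ (δ T L ⊕ δ T M)) ⟩
      sum (λ T → C T L ⊗ C T M) ⊕ sum (λ T → τ ⊗ (δ T L ⊕ δ T M))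
        ≡⟨ cong₂ _⊕_ sum-CC (trans (sum-cong-≗ (λ T → sym (ℤₚ.*-identityˡ (τ ⊗ (δ T L ⊕ δ T M))))) (sum-δδ (λ _ → 1ℤ))) ⟩
      (1ℤ ⊕ σ) ⊕ τ ⊗ (1ℤ ⊕ 1ℤ)
        ≡⟨ cong (λ a → (1ℤ ⊕ a) ⊕ τ ⊗ (1ℤ ⊕ 1ℤ)) σ≡τ² ⟩
      (1ℤ ⊕ τ ⊗ τ) ⊕ τ ⊗ (1ℤ ⊕ 1ℤ)
        ≡⟨ square τ ⟩
      (1ℤ ⊕ τ) ⊗ (1ℤ ⊕ τ) ∎
      where
      open ≡-Reasoning
      square : ∀ a → (1ℤ ⊕ a ⊗ a) ⊕ a ⊗ (1ℤ ⊕ 1ℤ) ≡ (1ℤ ⊕ a) ⊗ (1ℤ ⊕ a)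
      square = solve-∀

    Bv≡0 : ∀ p → sum (λ N → B p N ⊗ v N) ≡ 0ℤ
    Bv≡0 p = begin
      sum (λ N → B p N ⊗ v N)
        ≡⟨ sum-cong-≗ (λ N → distribute (B p N) (Cw N) (⊖ (σ ⊕ τ)) (w N) (⊖ (1ℤ ⊕ τ))) ⟩
      sum (λ N → 1ℤ ⊗ (B p N ⊗ Cw N) ⊕ 1ℤ ⊗ ((⊖ (σ ⊕ τ)) ⊗ (B p N ⊗ w N) ⊕ (⊖ (1ℤ ⊕ τ)) ⊗ B p N))
        ≡⟨ sum-linear 1ℤ 1ℤ (λ N → B p N ⊗ Cw N) (λ N → (⊖ (σ ⊕ τ)) ⊗ (B p N ⊗ w N) ⊕ (⊖ (1ℤ ⊕ τ)) ⊗ B p N) ⟩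
      1ℤ ⊗ sum (λ N → B p N ⊗ Cw N) ⊕ 1ℤ ⊗ sum (λ N → (⊖ (σ ⊕ τ)) ⊗ (B p N ⊗ w N) ⊕ (⊖ (1ℤ ⊕ τ)) ⊗ B p N)
        ≡⟨ cong₂ (λ a b → 1ℤ ⊗ a ⊕ 1ℤ ⊗ b) BCw
             (sum-linear (⊖ (σ ⊕ τ)) (⊖ (1ℤ ⊕ τ)) (λ N → B p N ⊗ w N) (B p)) ⟩
      1ℤ ⊗ ((σ ⊕ τ) ⊗ Bw ⊕ 1ℤ ⊗ sum w) ⊕ 1ℤ ⊗ ((⊖ (σ ⊕ τ)) ⊗ Bw ⊕ (⊖ (1ℤ ⊕ τ)) ⊗ sum (B p))
        ≡⟨ cong₂ (λ a b → 1ℤ ⊗ ((σ ⊕ τ) ⊗ Bw ⊕ 1ℤ ⊗ a) ⊕ 1ℤ ⊗ ((⊖ (σ ⊕ τ)) ⊗ Bw ⊕ (⊖ (1ℤ ⊕ τ)) ⊗ b)) sum-w (B-row p) ⟩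
      1ℤ ⊗ ((σ ⊕ τ) ⊗ Bw ⊕ 1ℤ ⊗ ((1ℤ ⊕ τ) ⊗ (1ℤ ⊕ τ))) ⊕ 1ℤ ⊗ ((⊖ (σ ⊕ τ)) ⊗ Bw ⊕ (⊖ (1ℤ ⊕ τ)) ⊗ (1ℤ ⊕ τ))
        ≡⟨ cancel (σ ⊕ τ) Bw (1ℤ ⊕ τ) ⟩
      0ℤ ∎
      where
      open ≡-Reasoning
      Bw : ℤ
      Bw = sum (λ N → B p N ⊗ w N)
      distribute : ∀ a b c d e → a ⊗ (b ⊕ c ⊗ d ⊕ e) ≡ 1ℤ ⊗ (a ⊗ b) ⊕ 1ℤ ⊗ (c ⊗ (a ⊗ d) ⊕ e ⊗ a)
      distribute = solve-∀
      distribute′ : ∀ a b c → (a ⊗ b ⊕ 1ℤ) ⊗ c ≡ a ⊗ (b ⊗ c) ⊕ 1ℤ ⊗ c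
      distribute′ = solve-∀
      cancel : ∀ a b c → 1ℤ ⊗ (a ⊗ b ⊕ 1ℤ ⊗ (c ⊗ c)) ⊕ 1ℤ ⊗ ((⊖ a) ⊗ b ⊕ (⊖ c) ⊗ c) ≡ 0ℤ
      cancel = solve-∀
      BCw : sum (λ N → B p N ⊗ Cw N) ≡ (σ ⊕ τ) ⊗ Bw ⊕ 1ℤ ⊗ sum w
      BCw = trans (sum-assoc (B p) C w)
              (trans (sum-cong-≗ (λ T → trans (cong (_⊗ w T) (BC p T)) (distribute′ (σ ⊕ τ) (B p T) (w T))))
                (sum-linear (σ ⊕ τ) 1ℤ (λ T → B p T ⊗ w T) w))

    v⊥rowspace : ∀ (f : Pt S → ℤ) → sum (λ N → v N ⊗ sum (λ p → B p N ⊗ f p)) ≡ 0ℤ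
    v⊥rowspace f = trans (sum-assoc v (λ N p → B p N) f)
      (sum-zero _ (λ p → cong (_⊗ f p)
        (trans (sum-cong-≗ (λ N → ℤₚ.*-comm (v N) (B p N))) (Bv≡0 p))))

    v⊥Cw : sum (λ N → v N ⊗ Cw N) ≡ 0ℤ
    v⊥Cw = trans (sum-cong-≗ (λ N → cong (v N ⊗_) (sym (sum-assoc (λ p → B p N) B w))))
             (v⊥rowspace (λ p → sum (λ T → B p T ⊗ w T)))

    sum-v : sum v ≡ 0ℤ
    sum-v = 1+σ-cancel (sum v) (begin
      sum v ⊗ (1ℤ ⊕ σ)                             ≡⟨ *-distribʳ-sum (1ℤ ⊕ σ) v ⟩
      sum (λ N → v N ⊗ (1ℤ ⊕ σ))                   ≡⟨ sum-cong-≗ (λ N → cong (v N ⊗_) (rowsum N)) ⟩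
      sum (λ N → v N ⊗ sum (λ p → B p N ⊗ 1ℤ))     ≡⟨ v⊥rowspace (λ _ → 1ℤ) ⟩
      0ℤ                                           ∎)
      where
      open ≡-Reasoning
      rowsum : ∀ N → 1ℤ ⊕ σ ≡ sum (λ p → B p N ⊗ 1ℤ)
      rowsum N = trans (sym (B-column N)) (sum-cong-≗ (λ p → sym (ℤₚ.*-identityʳ (B p N))))

    v-at-L : v L ≡ 0ℤ
    v-at-L = begin
      Cw L ⊕ (⊖ (σ ⊕ τ)) ⊗ w L ⊕ (⊖ (1ℤ ⊕ τ))
        ≡⟨ cong₂ (λ a b → a ⊕ (⊖ (σ ⊕ τ)) ⊗ b ⊕ (⊖ (1ℤ ⊕ τ))) Cw-L w-L ⟩
      ((1ℤ ⊕ σ) ⊕ τ ⊗ ((1ℤ ⊕ σ) ⊕ 0ℤ)) ⊕ (⊖ (σ ⊕ τ)) ⊗ (C L L ⊗ 0ℤ ⊕ τ ⊗ (1ℤ ⊕ 0ℤ)) ⊕ (⊖ (1ℤ ⊕ τ))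
        ≡⟨ cong (λ a → ((1ℤ ⊕ a) ⊕ τ ⊗ ((1ℤ ⊕ a) ⊕ 0ℤ)) ⊕ (⊖ (a ⊕ τ)) ⊗ (C L L ⊗ 0ℤ ⊕ τ ⊗ (1ℤ ⊕ 0ℤ)) ⊕ (⊖ (1ℤ ⊕ τ))) σ≡τ² ⟩
      ((1ℤ ⊕ τ ⊗ τ) ⊕ τ ⊗ ((1ℤ ⊕ τ ⊗ τ) ⊕ 0ℤ)) ⊕ (⊖ (τ ⊗ τ ⊕ τ)) ⊗ (C L L ⊗ 0ℤ ⊕ τ ⊗ (1ℤ ⊕ 0ℤ)) ⊕ (⊖ (1ℤ ⊕ τ))
        ≡⟨ arith τ (C L L) ⟩
      0ℤ ∎
      where
      open ≡-Reasoning
      arith : ∀ t c → ((1ℤ ⊕ t ⊗ t) ⊕ t ⊗ ((1ℤ ⊕ t ⊗ t) ⊕ 0ℤ)) ⊕ (⊖ (t ⊗ t ⊕ t)) ⊗ (c ⊗ 0ℤ ⊕ t ⊗ (1ℤ ⊕ 0ℤ)) ⊕ (⊖ (1ℤ ⊕ t)) ≡ 0ℤ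
      arith = solve-∀
      w-L : w L ≡ C L L ⊗ 0ℤ ⊕ τ ⊗ (1ℤ ⊕ 0ℤ)
      w-L = cong₂ (λ a b → C L L ⊗ a ⊕ τ ⊗ b) (C-disjoint L∦M) (cong₂ _⊕_ (δ-refl L) (δ-≢ L≢M))
      -- `C L T` repeats the 0/1 entry `C T L` except at `T = L`, where `C L M = 0` removes the
      -- diagonal entry 1 + s.
      term : ∀ T → C L T ⊗ (C T L ⊗ C T M) ≡ C T L ⊗ C T M
      term T with T ≟ L
      ... | yes refl = trans (cong (λ a → C T T ⊗ (C T T ⊗ a)) (C-disjoint L∦M))
                         (trans (zeros (C T T)) (cong (C T T ⊗_) (sym (C-disjoint L∦M))))
        where
        zeros : ∀ a → a ⊗ (a ⊗ 0ℤ) ≡ a ⊗ 0ℤ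
        zeros = solve-∀
      ... | no T≢L = trans (sym (ℤₚ.*-assoc (C L T) (C T L) (C T M))) (cong (_⊗ C T M)
                       (trans (cong₂ _⊗_ (trans (C-sym L T) (C-≢ T≢L)) (C-≢ T≢L))
                         (trans (⟦⟧-idem (meet? T L)) (sym (C-≢ T≢L)))))
      Cw-L : Cw L ≡ (1ℤ ⊕ σ) ⊕ τ ⊗ ((1ℤ ⊕ σ) ⊕ 0ℤ)
      Cw-L = trans (Cw-split L) (cong₂ (λ a b → a ⊕ τ ⊗ b) (trans (sum-cong-≗ term) sum-CC)
               (cong₂ _⊕_ (C-refl L) (C-disjoint L∦M)))

    v-at-transversal : ∀ {N} → N meets L → N meets M → v N ≡ 0ℤ
    v-at-transversal {N} N∩L N∩M = begin
      Cw N ⊕ (⊖ (σ ⊕ τ)) ⊗ w N ⊕ (⊖ (1ℤ ⊕ τ))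
        ≡⟨ cong₂ (λ a b → a ⊕ (⊖ (σ ⊕ τ)) ⊗ b ⊕ (⊖ (1ℤ ⊕ τ))) Cw-N w-N ⟩
      ((1ℤ ⊕ σ) ⊗ (1ℤ ⊗ 1ℤ) ⊕ τ ⊗ (1ℤ ⊕ 1ℤ)) ⊕ (⊖ (σ ⊕ τ)) ⊗ (1ℤ ⊗ 1ℤ ⊕ τ ⊗ (0ℤ ⊕ 0ℤ)) ⊕ (⊖ (1ℤ ⊕ τ))
        ≡⟨ arith σ τ ⟩
      0ℤ ∎
      where
      open ≡-Reasoning
      arith : ∀ s t → ((1ℤ ⊕ s) ⊗ (1ℤ ⊗ 1ℤ) ⊕ t ⊗ (1ℤ ⊕ 1ℤ)) ⊕ (⊖ (s ⊕ t)) ⊗ (1ℤ ⊗ 1ℤ ⊕ t ⊗ (0ℤ ⊕ 0ℤ)) ⊕ (⊖ (1ℤ ⊕ t)) ≡ 0ℤ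
      arith = solve-∀
      N≢L : N ≢ L
      N≢L refl = L∦M N∩M
      N≢M : N ≢ M
      N≢M refl = L∦M (meets-sym N∩L)
      w-N : w N ≡ 1ℤ ⊗ 1ℤ ⊕ τ ⊗ (0ℤ ⊕ 0ℤ)
      w-N = cong₂ (λ a b → a ⊕ τ ⊗ b) (cong₂ _⊗_ (C-meets N≢L N∩L) (C-meets N≢M N∩M)) (cong₂ _⊕_ (δ-≢ N≢L) (δ-≢ N≢M))
      -- A line `T ≠ N` meeting `N`, `L` and `M` passes, for lack of triangles, through the points
      -- of `N` on `L` and on `M`; these are then one point, and `L` meets `M`. So only `T = N`
      -- contributes.
      term : ∀ T → T ≢ N → C N T ⊗ (C T L ⊗ C T M) ≡ 0ℤ
      term T T≢N with T? (meet? N T) | T? (meet? T L) | T? (meet? T M)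
      ... | no ¬m | _ | _ = cong (_⊗ (C T L ⊗ C T M)) (C-disjoint (λ m → ¬m (meet?-intro m)))
      ... | yes _ | no ¬m | _ = trans (cong (λ a → C N T ⊗ (a ⊗ C T M)) (C-disjoint (λ m → ¬m (meet?-intro m))))
                                  (ℤₚ.*-zeroʳ (C N T))
      ... | yes _ | yes _ | no ¬m = trans (cong (λ a → C N T ⊗ (C T L ⊗ a)) (C-disjoint (λ m → ¬m (meet?-intro m))))
                                      (zeros (C N T) (C T L))
        where
        zeros : ∀ a b → a ⊗ (b ⊗ 0ℤ) ≡ 0ℤ
        zeros = solve-∀
      ... | yes nt | yes tl | yes tm with meet?-elim nt | meet?-elim tl | meet?-elim tm
      ...   | p , pN , pT | q , qT , qL | q′ , q′T , q′M =
        contradiction (p , no-triangle N≢T pN pT qT qL (proj₂ (proj₂ N∩L)) (proj₁ (proj₂ N∩L)) , no-triangle N≢T pN pT q′T q′M (proj₂ (proj₂ N∩M)) (proj₁ (proj₂ N∩M))) L∦M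
        where
        N≢T : N ≢ T
        N≢T = ≢-sym T≢N
      Cw-N : Cw N ≡ (1ℤ ⊕ σ) ⊗ (1ℤ ⊗ 1ℤ) ⊕ τ ⊗ (1ℤ ⊕ 1ℤ)
      Cw-N = trans (Cw-split N) (cong₂ (λ a b → a ⊕ τ ⊗ b)
        (trans (sum-single (λ T → C N T ⊗ (C T L ⊗ C T M)) N term)
          (cong₂ _⊗_ (C-refl N) (cong₂ _⊗_ (C-meets N≢L N∩L) (C-meets N≢M N∩M))))
        (cong₂ _⊕_ (C-meets N≢L N∩L) (C-meets N≢M N∩M)))

  -- Transversals of three pairwise disjoint lines.

  module _ (s≡t² : s ≡ t * t) where

    open Transversals s≡t² using (w; Cw; v; Cw-split; v⊥Cw; sum-v; v-at-L; v-at-transversal)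

    -- `w` is symmetric in `L` and `M`, so `v-at-L` also serves at `M`.
    v-swap : ∀ {L M} (d : ¬ L meets M) (d′ : ¬ M meets L) N → v d N ≡ v d′ N
    v-swap {L} {M} d d′ N =
      cong₂ (λ a b → a ⊕ (⊖ (σ ⊕ τ)) ⊗ b ⊕ (⊖ (1ℤ ⊕ τ))) (sum-cong-≗ (λ T → cong (C N T ⊗_) (w-swap T))) (w-swap N)
      where
      flip : ∀ a b c d e → a ⊗ b ⊕ c ⊗ (d ⊕ e) ≡ b ⊗ a ⊕ c ⊗ (e ⊕ d)
      flip = solve-∀
      w-swap : ∀ T → w d T ≡ w d′ T
      w-swap T = flip (C T L) (C T M) τ (δ T L) (δ T M)

    vw≡0 : ∀ {L M} (d : ¬ L meets M) N → v d N ⊗ w d N ≡ 0ℤ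
    vw≡0 {L} {M} d N with N ≟ L
    ... | yes refl = cong (_⊗ w d N) (v-at-L d)
    ... | no N≢L with N ≟ M
    ...   | yes refl = cong (_⊗ w d N) (trans (v-swap d (λ m → d (meets-sym m)) N) (v-at-L (λ m → d (meets-sym m))))
    ...   | no N≢M with T? (meet? N L) | T? (meet? N M)
    ...     | yes nl | yes nm = cong (_⊗ w d N) (v-at-transversal d (meet?-elim nl) (meet?-elim nm))
    ...     | no ¬nl | _ = trans (cong (v d N ⊗_) (cong₂ (λ a b → a ⊗ C N M ⊕ τ ⊗ b)
                               (C-disjoint (λ m → ¬nl (meet?-intro m))) (cong₂ _⊕_ (δ-≢ N≢L) (δ-≢ N≢M))))
                             (zeros (v d N) (C N M) τ)
      where
      zeros : ∀ a b c → a ⊗ (0ℤ ⊗ b ⊕ c ⊗ (0ℤ ⊕ 0ℤ)) ≡ 0ℤ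
      zeros = solve-∀
    ...     | yes _ | no ¬nm = trans (cong (v d N ⊗_) (cong₂ (λ a b → C N L ⊗ a ⊕ τ ⊗ b)
                               (C-disjoint (λ m → ¬nm (meet?-intro m))) (cong₂ _⊕_ (δ-≢ N≢L) (δ-≢ N≢M))))
                             (zeros (v d N) (C N L) τ)
      where
      zeros : ∀ a b c → a ⊗ (b ⊗ 0ℤ ⊕ c ⊗ (0ℤ ⊕ 0ℤ)) ≡ 0ℤ
      zeros = solve-∀

    v≡0 : ∀ {L M} (d : ¬ L meets M) N → v d N ≡ 0ℤ
    v≡0 d = sum-squares-zero (v d) (begin
      sum (λ N → v d N ⊗ v d N)
        ≡⟨ sum-cong-≗ square ⟩
      sum (λ N → 1ℤ ⊗ (v d N ⊗ Cw d N) ⊕ (⊖ (1ℤ ⊕ τ)) ⊗ v d N)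
        ≡⟨ sum-linear 1ℤ (⊖ (1ℤ ⊕ τ)) (λ N → v d N ⊗ Cw d N) (v d) ⟩
      1ℤ ⊗ sum (λ N → v d N ⊗ Cw d N) ⊕ (⊖ (1ℤ ⊕ τ)) ⊗ sum (v d)
        ≡⟨ cong₂ (λ a b → 1ℤ ⊗ a ⊕ (⊖ (1ℤ ⊕ τ)) ⊗ b) (v⊥Cw d) (sum-v d) ⟩
      1ℤ ⊗ 0ℤ ⊕ (⊖ (1ℤ ⊕ τ)) ⊗ 0ℤ
        ≡⟨ zeros (⊖ (1ℤ ⊕ τ)) ⟩
      0ℤ ∎)
      where
      open ≡-Reasoning
      zeros : ∀ a → 1ℤ ⊗ 0ℤ ⊕ a ⊗ 0ℤ ≡ 0ℤ
      zeros = solve-∀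
      expand : ∀ u a b c e → u ⊗ (a ⊕ b ⊗ c ⊕ e) ≡ 1ℤ ⊗ (u ⊗ a) ⊕ (b ⊗ (u ⊗ c) ⊕ e ⊗ u)
      expand = solve-∀
      drop : ∀ a b c → a ⊕ (b ⊗ 0ℤ ⊕ c) ≡ a ⊕ c
      drop = solve-∀
      square : ∀ N → v d N ⊗ v d N ≡ 1ℤ ⊗ (v d N ⊗ Cw d N) ⊕ (⊖ (1ℤ ⊕ τ)) ⊗ v d N
      square N = trans (expand (v d N) (Cw d N) (⊖ (σ ⊕ τ)) (w d N) (⊖ (1ℤ ⊕ τ)))
        (trans (cong (λ a → 1ℤ ⊗ (v d N ⊗ Cw d N) ⊕ ((⊖ (σ ⊕ τ)) ⊗ a ⊕ (⊖ (1ℤ ⊕ τ)) ⊗ v d N)) (vw≡0 d N))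
          (drop (1ℤ ⊗ (v d N ⊗ Cw d N)) (⊖ (σ ⊕ τ)) ((⊖ (1ℤ ⊕ τ)) ⊗ v d N)))

    -- At a line `N` disjoint from `L` and `M` the vector `w` is 0 and `C w` counts the
    -- transversals, so `v N = 0` fixes their number.
    triad-transversals : ∀ {L M N} → ¬ L meets M → ¬ N meets L → ¬ N meets M →
      count nl (λ T → meet? N T ∧ (meet? T L ∧ meet? T M)) ≡ suc t
    triad-transversals {L} {M} {N} L∦M N∦L N∦M = ℤₚ.+-injective (begin
      + count nl (λ T → meet? N T ∧ (meet? T L ∧ meet? T M))
        ≡⟨ sym (sum-count (λ T → meet? N T ∧ (meet? T L ∧ meet? T M))) ⟩
      sum (λ T → ⟦ meet? N T ∧ (meet? T L ∧ meet? T M) ⟧)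
        ≡⟨ sum-cong-≗ (λ T → sym (term T)) ⟩
      transversals
        ≡⟨ solve-for transversals τ (σ ⊕ τ) (trans (sym v-N) (v≡0 L∦M N)) ⟩
      1ℤ ⊕ τ
        ≡⟨ cong (1ℤ ⊕_) (sym +t≡τ) ⟩
      + suc t ∎)
      where
      open ≡-Reasoning
      transversals : ℤ
      transversals = sum (λ T → C N T ⊗ (C T L ⊗ C T M))
      N≢ : ∀ {K} → ¬ N meets K → N ≢ K
      N≢ N∦K refl with count-some (λ p → I p N) (linePts N)
      ... | p , pN = N∦K (p , pN , pN)
      v-N : v L∦M N ≡ (transversals ⊕ τ ⊗ (0ℤ ⊕ 0ℤ)) ⊕ (⊖ (σ ⊕ τ)) ⊗ (0ℤ ⊗ 0ℤ ⊕ τ ⊗ (0ℤ ⊕ 0ℤ)) ⊕ (⊖ (1ℤ ⊕ τ))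
      v-N = cong₂ (λ a b → a ⊕ (⊖ (σ ⊕ τ)) ⊗ b ⊕ (⊖ (1ℤ ⊕ τ)))
        (trans (Cw-split L∦M N) (cong (λ a → transversals ⊕ τ ⊗ a) (cong₂ _⊕_ (C-disjoint N∦L) (C-disjoint N∦M))))
        (cong₂ (λ a b → a ⊕ τ ⊗ b) (cong₂ _⊗_ (C-disjoint N∦L) (C-disjoint N∦M))
          (cong₂ _⊕_ (δ-≢ (N≢ N∦L)) (δ-≢ (N≢ N∦M))))
      solve-for : ∀ a b c → (a ⊕ b ⊗ (0ℤ ⊕ 0ℤ)) ⊕ (⊖ c) ⊗ (0ℤ ⊗ 0ℤ ⊕ b ⊗ (0ℤ ⊕ 0ℤ)) ⊕ (⊖ (1ℤ ⊕ b)) ≡ 0ℤ → a ≡ 1ℤ ⊕ b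
      solve-for a b c eq = trans (rearrange a b c) (trans (cong (_⊕ (1ℤ ⊕ b)) eq) (ℤₚ.+-identityˡ (1ℤ ⊕ b)))
        where
        rearrange : ∀ a b c → a ≡ ((a ⊕ b ⊗ (0ℤ ⊕ 0ℤ)) ⊕ (⊖ c) ⊗ (0ℤ ⊗ 0ℤ ⊕ b ⊗ (0ℤ ⊕ 0ℤ)) ⊕ (⊖ (1ℤ ⊕ b))) ⊕ (1ℤ ⊕ b)
        rearrange = solve-∀
      both-zero : ∀ {a b} → a ≡ 0ℤ → ¬ T b → a ≡ ⟦ b ⟧
      both-zero a≡0 ¬b = trans a≡0 (sym (⟦⟧-false ¬b))
      -- Entries of `C` are 0/1 only off the diagonal; if `T` is one of the three lines,
      -- disjointness makes some factor vanish.
      term : ∀ T → C N T ⊗ (C T L ⊗ C T M) ≡ ⟦ meet? N T ∧ (meet? T L ∧ meet? T M) ⟧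
      term T with T ≟ L | T ≟ M | T ≟ N
      ... | yes refl | _ | _ = both-zero
        (cong (_⊗ (C L L ⊗ C L M)) (C-disjoint N∦L)) λ h → N∦L (meet?-elim (proj₁ (T-elim h)))
      ... | no _ | yes refl | _ = both-zero
        (cong (_⊗ (C M L ⊗ C M M)) (C-disjoint N∦M)) λ h → N∦M (meet?-elim (proj₁ (T-elim h)))
      ... | no _ | no _ | yes refl = both-zero
        (trans (cong (λ a → C N N ⊗ (a ⊗ C N M)) (C-disjoint N∦L)) (ℤₚ.*-zeroʳ (C N N)))
        λ h → N∦L (meet?-elim (proj₁ (T-elim {b = meet? N M} (proj₂ (T-elim {meet? N N} h)))))
      ... | no T≢L | no T≢M | no T≢N =
        trans (cong₂ _⊗_ (C-≢ (≢-sym T≢N)) (trans (cong₂ _⊗_ (C-≢ T≢L) (C-≢ T≢M)) (sym (⟦⟧-∧ (meet? T L) (meet? T M)))))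
              (sym (⟦⟧-∧ (meet? N T) (meet? T L ∧ meet? T M)))

-- Kantor families with normal subgroups P i

module KantorFamily
  (G : Group 0ℓ 0ℓ) (J : Set) (_#_ : J → J → Set)
  (P Q : J → Group.Carrier G → Set)
  where

  open Group G renaming (sym to ≈-sym; trans to ≈-trans)
  open GroupProperties G using (∙-cancelˡ; ∙-cancelʳ; \\-leftDividesˡ; \\-leftDividesʳ)
  open import Relation.Binary.Reasoning.Setoid setoid

  record Closed (K : Carrier → Set) : Set where
    field
      resp : ∀ {g h} → g ≈ h → K g → K h
      unit : K ε
      mult : ∀ {g h} → K g → K h → K (g ∙ h)
      inv  : ∀ {g} → K g → K (g ⁻¹)

  -- The abstract counterpart of 𝕊. By `P∩P⊆Z` it is already the intersection of any two `P i` with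
  -- `#`-related indices.
  Z : Carrier → Set
  Z g = ∀ i → P i g

  record Axioms : Set where
    field
      #-sym      : ∀ {i j} → i # j → j # i
      third      : ∀ i j → ∃ λ k → i # k × j # k
      i₀      : J
      P-closed   : ∀ i → Closed (P i)
      Q-closed   : ∀ i → Closed (Q i)
      P-normal   : ∀ i {g} h → P i g → P i (h ⁻¹ ∙ (g ∙ h))
      Q⊆P        : ∀ {i g} → Q i g → P i g
      P∩P⊆Z      : ∀ {i j g} → i # j → P i g → P j g → Z g
      Q∩P-trivial : ∀ {i j g} → i # j → Q i g → P j g → g ≈ ε
      trivial?   : ∀ g → Dec (g ≈ ε)
      nontrivial : ∀ i → ∃ λ b → Q i b × ¬ b ≈ ε
      P⊆ZQ       : ∀ i {p} → P i p → ∃₂ λ z q → Z z × Q i q × p ≈ z ∙ q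
      factor     : ∀ {i j} → i # j → ∀ h → ∃₂ λ q p → Q j q × P i p × h ≈ q ∙ p
      -- A transversal of `L_i`, `M_j` and `h M_j` in group terms; this is the axiom that rests on s
      -- = t².
      transversal : ∀ {i j} → i # j → ∀ h → ¬ P j h →
                    ∃ λ a → ∃₂ λ a′ b′ → Q j a × Q j a′ × Q i b′ × ¬ a ≈ ε × h ∙ a′ ≈ a ∙ b′

  module _ (ax : Axioms) where
    open Axioms ax
    module Pᶜ i = Closed (P-closed i)
    module Qᶜ i = Closed (Q-closed i)

    regroup : ∀ x y z w → x ∙ (y ∙ (z ∙ w)) ≈ (x ∙ (y ∙ z)) ∙ w
    regroup x y z w = ≈-trans (∙-congˡ (≈-sym (assoc y z w))) (≈-sym (assoc x (y ∙ z) w))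

    -- Commutators modulo `Z`.

    Commute-mod-Z : Carrier → Carrier → Set
    Commute-mod-Z a h = ∃ λ z → Z z × a ∙ h ≈ h ∙ (a ∙ z)

    -- By normality the commutator lies in `P i` as `a⁻¹ (h⁻¹ a h)` and in `P j` as `(a⁻¹ h⁻¹ a) h`.
    P-P-commute : ∀ {i j a h} → i # j → P i a → P j h → Commute-mod-Z a h
    P-P-commute {i} {j} {a} {h} i#j pa ph = a ⁻¹ ∙ (h ⁻¹ ∙ (a ∙ h)) ,
      P∩P⊆Z i#j (Pᶜ.mult i (Pᶜ.inv i pa) (P-normal i h pa))
        (Pᶜ.resp j (≈-sym (regroup (a ⁻¹) (h ⁻¹) a h)) (Pᶜ.mult j (P-normal j a (Pᶜ.inv j ph)) ph)) ,
      ≈-sym (≈-trans (∙-congˡ (\\-leftDividesˡ a _)) (\\-leftDividesˡ h _))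

    Commute-mod-Z-∙ : ∀ {a q p} → Commute-mod-Z a q → Commute-mod-Z a p → Commute-mod-Z a (q ∙ p)
    Commute-mod-Z-∙ {a} {q} {p} (y , Zy , eq) (z , Zz , ep) =
      z ∙ y′ , (λ i → Pᶜ.mult i (Zz i) (P-normal i p (Zy i))) , (begin
        a ∙ (q ∙ p)              ≈⟨ ≈-sym (assoc a q p) ⟩
        (a ∙ q) ∙ p              ≈⟨ ∙-congʳ eq ⟩
        (q ∙ (a ∙ y)) ∙ p        ≈⟨ assoc q (a ∙ y) p ⟩
        q ∙ ((a ∙ y) ∙ p)        ≈⟨ ∙-congˡ (assoc a y p) ⟩
        q ∙ (a ∙ (y ∙ p))        ≈⟨ ∙-congˡ (∙-congˡ (≈-sym (\\-leftDividesˡ p (y ∙ p)))) ⟩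
        q ∙ (a ∙ (p ∙ y′))       ≈⟨ ∙-congˡ (≈-sym (assoc a p y′)) ⟩
        q ∙ ((a ∙ p) ∙ y′)       ≈⟨ ∙-congˡ (∙-congʳ ep) ⟩
        q ∙ ((p ∙ (a ∙ z)) ∙ y′) ≈⟨ ∙-congˡ (assoc p (a ∙ z) y′) ⟩
        q ∙ (p ∙ ((a ∙ z) ∙ y′)) ≈⟨ ≈-sym (assoc q p _) ⟩
        (q ∙ p) ∙ ((a ∙ z) ∙ y′) ≈⟨ ∙-congˡ (assoc a z y′) ⟩
        (q ∙ p) ∙ (a ∙ (z ∙ y′)) ∎)
      where
      -- `Z` is so far known to be normal, not central: carrying `y` past `p` conjugates it.
      y′ : Carrier
      y′ = p ⁻¹ ∙ (y ∙ p)

    -- Modulo Z, every element is a product from two other components, and these commute with Q i.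
    Q-abelian : ∀ {i a b} → Q i a → Q i b → a ∙ b ≈ b ∙ a
    Q-abelian {i} {a} {b} qa qb with third i i
    ... | j , i#j , _ with third i j
    ...   | k , i#k , j#k with factor (#-sym j#k) b
    ...     | q , p , qq , pp , b≈qp
      with Commute-mod-Z-∙ (P-P-commute i#j (Q⊆P qa) (Q⊆P qq)) (P-P-commute i#k (Q⊆P qa) pp)
    ...       | z , Zz , eq = begin
      a ∙ b        ≈⟨ ab≈baz ⟩
      b ∙ (a ∙ z)  ≈⟨ ∙-congˡ (∙-congˡ z≈ε) ⟩
      b ∙ (a ∙ ε)  ≈⟨ ∙-congˡ (identityʳ a) ⟩
      b ∙ a        ∎
      where
      ab≈baz : a ∙ b ≈ b ∙ (a ∙ z)
      ab≈baz = ≈-trans (∙-congˡ b≈qp) (≈-trans eq (∙-congʳ (≈-sym b≈qp)))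
      -- `z` is a commutator of elements of `Q i`, hence in `Q i`, which meets `Z` trivially.
      z≈ : a ⁻¹ ∙ (b ⁻¹ ∙ (a ∙ b)) ≈ z
      z≈ = ≈-trans (∙-congˡ (≈-trans (∙-congˡ ab≈baz) (\\-leftDividesʳ b _))) (\\-leftDividesʳ a z)
      z≈ε : z ≈ ε
      z≈ε = Q∩P-trivial i#j
        (Qᶜ.resp i z≈ (Qᶜ.mult i (Qᶜ.inv i qa) (Qᶜ.mult i (Qᶜ.inv i qb) (Qᶜ.mult i qa qb)))) (Zz j)

    equal-if-quotient-trivial : ∀ {a b} → a ⁻¹ ∙ b ≈ ε → b ≈ a
    equal-if-quotient-trivial {a} {b} e =
      ≈-trans (≈-sym (\\-leftDividesˡ a b)) (≈-trans (∙-congˡ e) (identityʳ a))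

    -- The equation is the commutator formula `z = b⁻¹ a b a⁻¹` without inverses. For a fixed `b` it
    -- reaches every `z`, with `a` depending on `z`.
    commutator-onto-Z : ∀ {i j b z} → i # j → Q i b → ¬ b ≈ ε → Z z →
                        ∃ λ a → Q j a × ¬ a ≈ ε × (b ∙ z) ∙ a ≈ a ∙ b
    commutator-onto-Z {i} {j} {b} {z} i#j qb b≉ε Zz
      -- `b z` in `P j` would put `b` into the trivial intersection of `Q i` and `P j`.
      with transversal i#j (b ∙ z) (λ ph → b≉ε (Q∩P-trivial i#j qb
             (Pᶜ.resp j (≈-trans (assoc b z (z ⁻¹)) (≈-trans (∙-congˡ (inverseʳ z)) (identityʳ b)))
               (Pᶜ.mult j ph (Pᶜ.inv j (Zz j))))))
    ... | a , a′ , b′ , qa , qa′ , qb′ , a≉ε , eq = a , qa , a≉ε ,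
      ≈-trans hₐ (∙-congˡ b′≈b)
      where
      h : Carrier
      h = b ∙ z
      -- `h` and `b′` lie in the normal subgroup `P i`, so `a⁻¹ a′` is in `Q j` and in `P i`.
      -- Symmetrically, `b⁻¹ b′` below is in `Q i` and in `P j`.
      a′≈a : a′ ≈ a
      a′≈a = equal-if-quotient-trivial (Q∩P-trivial (#-sym i#j) (Qᶜ.mult j (Qᶜ.inv j qa) qa′)
        (Pᶜ.resp i (begin
            (a ⁻¹ ∙ (h ⁻¹ ∙ a)) ∙ b′  ≈⟨ ≈-sym (regroup (a ⁻¹) (h ⁻¹) a b′) ⟩
            a ⁻¹ ∙ (h ⁻¹ ∙ (a ∙ b′))  ≈⟨ ∙-congˡ (∙-congˡ (≈-sym eq)) ⟩
            a ⁻¹ ∙ (h ⁻¹ ∙ (h ∙ a′))  ≈⟨ ∙-congˡ (\\-leftDividesʳ h a′) ⟩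
            a ⁻¹ ∙ a′                 ∎)
          (Pᶜ.mult i (P-normal i a (Pᶜ.inv i (Pᶜ.mult i (Q⊆P qb) (Zz i)))) (Q⊆P qb′))))
      hₐ : h ∙ a ≈ a ∙ b′
      hₐ = ≈-trans (∙-congˡ (≈-sym a′≈a)) eq
      b′≈b : b′ ≈ b
      b′≈b = equal-if-quotient-trivial (Q∩P-trivial i#j (Qᶜ.mult i (Qᶜ.inv i qb) qb′)
        (Pᶜ.resp j (begin
            (b ⁻¹ ∙ (a ⁻¹ ∙ b)) ∙ (z ∙ a)  ≈⟨ ≈-sym (regroup (b ⁻¹) (a ⁻¹) b (z ∙ a)) ⟩
            b ⁻¹ ∙ (a ⁻¹ ∙ (b ∙ (z ∙ a)))  ≈⟨ ∙-congˡ (∙-congˡ (≈-sym (assoc b z a))) ⟩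
            b ⁻¹ ∙ (a ⁻¹ ∙ (h ∙ a))        ≈⟨ ∙-congˡ (∙-congˡ hₐ) ⟩
            b ⁻¹ ∙ (a ⁻¹ ∙ (a ∙ b′))       ≈⟨ ∙-congˡ (\\-leftDividesʳ a b′) ⟩
            b ⁻¹ ∙ b′                      ∎)
          (Pᶜ.mult j (P-normal j b (Pᶜ.inv j (Q⊆P qa))) (Pᶜ.mult j (Zz j) (Q⊆P qa)))))

    commute-∙ : ∀ {y g h} → y ∙ g ≈ g ∙ y → y ∙ h ≈ h ∙ y → y ∙ (g ∙ h) ≈ (g ∙ h) ∙ y
    commute-∙ {y} {g} {h} yg yh = begin
      y ∙ (g ∙ h)  ≈⟨ ≈-sym (assoc y g h) ⟩
      (y ∙ g) ∙ h  ≈⟨ ∙-congʳ yg ⟩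
      (g ∙ y) ∙ h  ≈⟨ assoc g y h ⟩
      g ∙ (y ∙ h)  ≈⟨ ∙-congˡ yh ⟩
      g ∙ (h ∙ y)  ≈⟨ ≈-sym (assoc g h y) ⟩
      (g ∙ h) ∙ y  ∎

    -- The equation writes `z` as a word in `a` and `b`, so whatever commutes with both commutes
    -- with `z`.
    commute-commutator : ∀ {y a b z} → (b ∙ z) ∙ a ≈ a ∙ b → y ∙ a ≈ a ∙ y → y ∙ b ≈ b ∙ y → y ∙ z ≈ z ∙ y
    commute-commutator {y} {a} {b} {z} eq ya yb = ∙-cancelˡ b _ _ (∙-cancelʳ a _ _ (begin
      (b ∙ (y ∙ z)) ∙ a  ≈⟨ ∙-congʳ (≈-sym (assoc b y z)) ⟩
      ((b ∙ y) ∙ z) ∙ a  ≈⟨ ∙-congʳ (∙-congʳ (≈-sym yb)) ⟩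
      ((y ∙ b) ∙ z) ∙ a  ≈⟨ ∙-congʳ (assoc y b z) ⟩
      (y ∙ (b ∙ z)) ∙ a  ≈⟨ assoc y (b ∙ z) a ⟩
      y ∙ ((b ∙ z) ∙ a)  ≈⟨ ∙-congˡ eq ⟩
      y ∙ (a ∙ b)        ≈⟨ commute-∙ ya yb ⟩
      (a ∙ b) ∙ y        ≈⟨ ∙-congʳ (≈-sym eq) ⟩
      ((b ∙ z) ∙ a) ∙ y  ≈⟨ assoc (b ∙ z) a y ⟩
      (b ∙ z) ∙ (a ∙ y)  ≈⟨ ∙-congˡ (≈-sym ya) ⟩
      (b ∙ z) ∙ (y ∙ a)  ≈⟨ ≈-sym (assoc (b ∙ z) y a) ⟩
      ((b ∙ z) ∙ y) ∙ a  ≈⟨ ∙-congʳ (assoc b z y) ⟩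
      (b ∙ (z ∙ y)) ∙ a  ∎))

    -- a commutes with some b ≠ 1 in another component, and every z ∈ Z is a commutator of that b
    -- with an element of Q j, which commutes with a.
    Q-centralises-Z : ∀ {j a z} → Q j a → Z z → a ∙ z ≈ z ∙ a
    Q-centralises-Z {j} {a} {z} qa Zz with trivial? a
    ... | yes a≈ε = ≈-trans (∙-congʳ a≈ε) (≈-trans (identityˡ z) (≈-sym (≈-trans (∙-congˡ a≈ε) (identityʳ z))))
    ... | no a≉ε with third j j
    ...   | i , j#i , _ with commutator-onto-Z j#i qa a≉ε (λ k → Pᶜ.unit k)
    ...     | b , qb , b≉ε , ab≈ba with commutator-onto-Z (#-sym j#i) qb b≉ε Zz
    ...       | a′ , qa′ , _ , eq =
      commute-commutator eq (Q-abelian qa qa′) (≈-trans (∙-congʳ (≈-sym (identityʳ a))) ab≈ba)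

    -- `z` is a commutator of elements of two `Q` components, and `y` commutes with both of them.
    Z-abelian : ∀ {y z} → Z y → Z z → y ∙ z ≈ z ∙ y
    Z-abelian Zy Zz with nontrivial i₀ | third i₀ i₀
    ... | b , qb , b≉ε | j , i#j , _ with commutator-onto-Z i#j qb b≉ε Zz
    ...   | a , qa , _ , eq =
      commute-commutator eq (≈-sym (Q-centralises-Z qa Zy)) (≈-sym (Q-centralises-Z qb Zy))

    Z-central : ∀ {z} → Z z → ∀ h → z ∙ h ≈ h ∙ z
    Z-central {z} Zz h with third i₀ i₀
    ... | j , i#j , _ with factor i#j h
    ...   | q , p , qq , pp , h≈qp with P⊆ZQ i₀ pp
    ...     | y , q′ , Zy , qq′ , p≈yq′ = begin
      z ∙ h               ≈⟨ ∙-congˡ h≈ ⟩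
      z ∙ (q ∙ (y ∙ q′))  ≈⟨ commute-∙ (≈-sym (Q-centralises-Z qq Zz))
                               (commute-∙ (Z-abelian Zz Zy) (≈-sym (Q-centralises-Z qq′ Zz))) ⟩
      (q ∙ (y ∙ q′)) ∙ z  ≈⟨ ∙-congʳ (≈-sym h≈) ⟩
      h ∙ z               ∎
      where
      h≈ : h ≈ q ∙ (y ∙ q′)
      h≈ = ≈-trans h≈qp (∙-congˡ p≈yq′)

-- The elation group

module Automorphisms (S : IncStr) where
  open IncStr S

  pres-on : ∀ (g : Aut S) {p L} → T (I p L) → T (I (pf g p) (lf g L))
  pres-on g {p} {L} = subst T (sym (pres g p L))

  reflect-on : ∀ (g : Aut S) {p L} → T (I (pf g p) (lf g L)) → T (I p L)
  reflect-on g {p} {L} = subst T (pres g p L)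

  pf-injective : ∀ (g : Aut S) {p q} → pf g p ≡ pf g q → p ≡ q
  pf-injective g {p} {q} e = trans (sym (pinvˡ g p)) (trans (cong (pinv g) e) (pinvˡ g q))

  lf-injective : ∀ (g : Aut S) {L M} → lf g L ≡ lf g M → L ≡ M
  lf-injective g {L} {M} e = trans (sym (linvˡ g L)) (trans (cong (linv g) e) (linvˡ g M))

  module _ {H : Aut S → Set} (subgroup : IsSubgroup S H) where
    open IsSubgroup subgroup

    Element : Set
    Element = Σ (Aut S) H

    infixl 7 _∘ᴴ_

    _∘ᴴ_ : Element → Element → Element
    (g , Hg) ∘ᴴ (h , Hh) = let k , Hk , _ = closed g h Hg Hh in k , Hk

    idᴴ : Element
    idᴴ = let e , He , _ = hasId in e , He

    _⁻ᴴ : Element → Element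
    (g , Hg) ⁻ᴴ = let k , Hk , _ = invs g Hg in k , Hk

    pᴴ : Element → Pt S → Pt S
    pᴴ (g , _) = pf g

    lᴴ : Element → Ln S → Ln S
    lᴴ (g , _) = lf g

    p-∘ : ∀ g h p → pᴴ (g ∘ᴴ h) p ≡ pᴴ g (pᴴ h p)
    p-∘ (g , Hg) (h , Hh) = let _ , _ , c = closed g h Hg Hh in proj₁ c

    l-∘ : ∀ g h L → lᴴ (g ∘ᴴ h) L ≡ lᴴ g (lᴴ h L)
    l-∘ (g , Hg) (h , Hh) = let _ , _ , c = closed g h Hg Hh in proj₂ c

    p-id : ∀ p → pᴴ idᴴ p ≡ p
    p-id = let _ , _ , i = hasId in proj₁ i

    l-id : ∀ L → lᴴ idᴴ L ≡ L
    l-id = let _ , _ , i = hasId in proj₂ i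

    p-inverseˡ : ∀ g p → pᴴ (g ⁻ᴴ) (pᴴ g p) ≡ p
    p-inverseˡ (g , Hg) p = let _ , _ , _ , i , c = invs g Hg in trans (sym (proj₁ c p)) (proj₁ i p)

    l-inverseˡ : ∀ g L → lᴴ (g ⁻ᴴ) (lᴴ g L) ≡ L
    l-inverseˡ (g , Hg) L = let _ , _ , _ , i , c = invs g Hg in trans (sym (proj₂ c L)) (proj₂ i L)

    p-inverseʳ : ∀ g p → pᴴ g (pᴴ (g ⁻ᴴ) p) ≡ p
    p-inverseʳ g p = pf-injective (proj₁ (g ⁻ᴴ)) (p-inverseˡ g (pᴴ (g ⁻ᴴ) p))

    l-inverseʳ : ∀ g L → lᴴ g (lᴴ (g ⁻ᴴ) L) ≡ L
    l-inverseʳ g L = lf-injective (proj₁ (g ⁻ᴴ)) (l-inverseˡ g (lᴴ (g ⁻ᴴ) L))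

    infix 4 _≈ᴴ_

    -- Elements are compared by their action, since an `Aut` also carries inverse maps and proofs as
    -- data and composites in `H` are specified only by their action.
    _≈ᴴ_ : Element → Element → Set
    g ≈ᴴ h = _≈A_ S (proj₁ g) (proj₁ h)

    ⁻ᴴ-cong : ∀ g h → g ≈ᴴ h → g ⁻ᴴ ≈ᴴ h ⁻ᴴ
    ⁻ᴴ-cong g h (e , f) =
      (λ p → pf-injective (proj₁ g) (trans (p-inverseʳ g p) (sym (trans (e (pᴴ (h ⁻ᴴ) p)) (p-inverseʳ h p))))) ,
      (λ L → lf-injective (proj₁ g) (trans (l-inverseʳ g L) (sym (trans (f (lᴴ (h ⁻ᴴ) L)) (l-inverseʳ h L)))))

    group : Group 0ℓ 0ℓ
    group = record
      { Carrier = Element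
      ; _≈_ = _≈ᴴ_
      ; _∙_ = _∘ᴴ_
      ; ε = idᴴ
      ; _⁻¹ = _⁻ᴴ
      ; isGroup = record
        { isMonoid = record
          { isSemigroup = record
            { isMagma = record
              { isEquivalence = record
                { refl = (λ _ → refl) , (λ _ → refl)
                ; sym = λ e → (λ p → sym (proj₁ e p)) , (λ L → sym (proj₂ e L))
                ; trans = λ e f → (λ p → trans (proj₁ e p) (proj₁ f p)) , (λ L → trans (proj₂ e L) (proj₂ f L))
                }
              ; ∙-cong = λ {g} {g′} {h} {h′} e f →
                  (λ p → trans (p-∘ g h p) (trans (proj₁ e _) (trans (cong (pᴴ g′) (proj₁ f p)) (sym (p-∘ g′ h′ p))))) ,
                  (λ L → trans (l-∘ g h L) (trans (proj₂ e _) (trans (cong (lᴴ g′) (proj₂ f L)) (sym (l-∘ g′ h′ L)))))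
              }
            ; assoc = λ g h k →
                (λ p → trans (p-∘ (g ∘ᴴ h) k p) (trans (p-∘ g h (pᴴ k p))
                         (sym (trans (p-∘ g (h ∘ᴴ k) p) (cong (pᴴ g) (p-∘ h k p)))))) ,
                (λ L → trans (l-∘ (g ∘ᴴ h) k L) (trans (l-∘ g h (lᴴ k L))
                         (sym (trans (l-∘ g (h ∘ᴴ k) L) (cong (lᴴ g) (l-∘ h k L))))))
            }
          ; identity =
              (λ g → (λ p → trans (p-∘ idᴴ g p) (p-id (pᴴ g p))) , (λ L → trans (l-∘ idᴴ g L) (l-id (lᴴ g L)))) ,
              (λ g → (λ p → trans (p-∘ g idᴴ p) (cong (pᴴ g) (p-id p))) , (λ L → trans (l-∘ g idᴴ L) (cong (lᴴ g) (l-id L))))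
          }
        ; inverse =
            (λ g → (λ p → trans (p-∘ (g ⁻ᴴ) g p) (trans (p-inverseˡ g p) (sym (p-id p)))) ,
                   (λ L → trans (l-∘ (g ⁻ᴴ) g L) (trans (l-inverseˡ g L) (sym (l-id L))))) ,
            (λ g → (λ p → trans (p-∘ g (g ⁻ᴴ) p) (trans (p-inverseʳ g p) (sym (p-id p)))) ,
                   (λ L → trans (l-∘ g (g ⁻ᴴ) L) (trans (l-inverseʳ g L) (sym (l-id L)))))
        ; ⁻¹-cong = λ {g} {h} → ⁻ᴴ-cong g h
        }
      }

-- The Kantor family at a point opposite `x`.

module SkewTranslation
  (S : IncStr) (t : ℕ) (x : Pt S) (H : Aut S → Set) (𝕊 : Fin t → Aut S)
  (t≥2 : t ≥ 2) (stgq : IsSTGQ S (t * t) t x H 𝕊) (star : PropertyStar S x H)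
  where

  open IncStr S using (np; nl; I)
  open IsSTGQ stgq
  open IsEGQ egq renaming (trans to transitive)
  open GQ S (t * t) t gq hiding (J)
  open IsGQ gq using (linePts; ptLines)
  module Sym = SymGroup symg
  open Automorphisms S

  lines≥3 : ∀ p → count nl (λ L → I p L) ≥ 3
  lines≥3 p = subst (_≥ 3) (sym (ptLines p)) (s≤s t≥2)

  points≥3 : ∀ L → count np (λ p → I p L) ≥ 3
  points≥3 L = subst (_≥ 3) (sym (linePts L)) (s≤s (ℕₚ.*-mono-≤ t≥2 (ℕₚ.≤-trans (s≤s z≤n) t≥2)))

  Opposite : Pt S → Set
  Opposite y = ¬ x ~ y

  -- A point `z` on a second line `N` through a point `u` of `L` will do: `x ~ z` would close a
  -- triangle.
  opposite-exists : ∃ Opposite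
  opposite-exists with count-some (λ L → I x L) (ptLines x)
  ... | L , xL with count-avoid (λ p → I p L) (points≥3 L) x x
  ...   | u , uL , u≢x , _ with count-avoid (λ M → I u M) (lines≥3 u) L L
  ...     | N , uN , N≢L , _ with count-avoid (λ p → I p N) (points≥3 N) u u
  ...       | z , zN , z≢u , _ = z , x≁z
    where
    x≁z : ¬ x ~ z
    x≁z xz with ~-elim xz
    ... | K , xK , zK with line-unique xK (no-triangle (≢-sym N≢L) uL uN zN zK xK xL) xL uL (≢-sym u≢x)
    ...   | refl = z≢u (point-unique N≢L zN zK uN uL)

  J : Set
  J = ∃ λ L → x on L

  _#_ : J → J → Set
  (L , _) # (M , _) = L ≢ M

  module Based (z : Pt S) (x≁z : Opposite z) where

    off : ∀ (i : J) → ¬ z on proj₁ i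
    off (L , xL) zL = x≁z (~-intro xL zL)

    opaque
      u : J → Pt S
      u i = proj₁ (project (off i))

      u-on : ∀ i → u i on proj₁ i
      u-on i = proj₁ (proj₂ (project (off i)))

      M : J → Ln S
      M i = proj₁ (~-elim (proj₂ (proj₂ (project (off i)))))

      z-on-M : ∀ i → z on M i
      z-on-M i = proj₁ (proj₂ (~-elim (proj₂ (proj₂ (project (off i))))))

      u-on-M : ∀ i → u i on M i
      u-on-M i = proj₂ (proj₂ (~-elim (proj₂ (proj₂ (project (off i))))))

    x~u : ∀ i → x ~ u i
    x~u i = ~-intro (proj₂ i) (u-on i)

    u≢x : ∀ i → u i ≢ x
    u≢x i e = x≁z (~-intro (subst (_on M i) e (u-on-M i)) (z-on-M i))

    M≢L : ∀ i → M i ≢ proj₁ i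
    M≢L i e = off i (subst (z on_) e (z-on-M i))

    opposite-off : ∀ {y} (i : J) → Opposite y → ¬ y on proj₁ i
    opposite-off i x≁y yL = x≁y (~-intro (proj₂ i) yL)

    line-to-unique : ∀ {y N N′ q q′} (i : J) → Opposite y → y on N → y on N′ →
                     q on N → q on proj₁ i → q′ on N′ → q′ on proj₁ i → N ≡ N′
    line-to-unique {N = N} {N′} i x≁y yN yN′ qN qL q′N′ q′L = decidable-stable (N ≟ N′) λ N≢N′ →
      opposite-off i x≁y (no-triangle N≢N′ yN yN′ q′N′ q′L qL qN)

    cross : ∀ {i j : J} → i # j → ∀ {p q} → p on proj₁ i → p ≢ x → q on proj₁ j → q ≢ x → ¬ p ~ q
    cross {i} {j} i#j pL p≢x qL q≢x pq with ~-elim pq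
    ... | K , pK , qK = i#j (trans (line-unique pL (proj₂ i) pK xK p≢x) (line-unique qK xK qL (proj₂ j) q≢x))
      where
      xK : x on K
      xK = no-triangle i#j (proj₂ i) (proj₂ j) qL qK pK pL

    G : Group 0ℓ 0ℓ
    G = group subgroup

    open Group G using (Carrier; _≈_; _∙_; ε; _⁻¹)

    infixr 6 _·_ _·ˡ_

    _·_ : Carrier → Pt S → Pt S
    _·_ = pᴴ subgroup

    _·ˡ_ : Carrier → Ln S → Ln S
    _·ˡ_ = lᴴ subgroup

    ∙-act : ∀ g h p → (g ∙ h) · p ≡ g · h · p
    ∙-act = p-∘ subgroup

    act-on : ∀ g {p L} → p on L → g · p on g ·ˡ L
    act-on (g , _) = pres-on g

    act-on⁻ : ∀ g {p L} → p on g ·ˡ L → g ⁻¹ · p on L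
    act-on⁻ g {p} {L} h = subst (g ⁻¹ · p on_) (l-inverseˡ subgroup g L) (act-on (g ⁻¹) h)

    fix-L : ∀ g (i : J) → g ·ˡ proj₁ i ≡ proj₁ i
    fix-L (g , Hg) (L , xL) = fixLines g Hg L xL

    act-on-L : ∀ g (i : J) {p} → p on proj₁ i → g · p on proj₁ i
    act-on-L g i {p} pL = subst (g · p on_) (fix-L g i) (act-on g pL)

    third : ∀ (i j : J) → ∃ λ k → i # k × j # k
    third i j with count-avoid (λ L → I x L) (lines≥3 x) (proj₁ i) (proj₁ j)
    ... | K , xK , K≢i , K≢j = (K , xK) , ≢-sym K≢i , ≢-sym K≢j

    i₀ : J
    i₀ = count-some (λ L → I x L) (ptLines x)

    fix-x : ∀ g → g · x ≡ x
    fix-x g with third i₀ i₀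
    ... | j , i#j , _ = point-unique i#j (act-on-L g i₀ (proj₂ i₀)) (act-on-L g j (proj₂ j)) (proj₂ i₀) (proj₂ j)

    act-≢x : ∀ g {p} → p ≢ x → g · p ≢ x
    act-≢x g p≢x e = p≢x (pf-injective (proj₁ g) (trans e (sym (fix-x g))))

    act-~ : ∀ g {p q} → p ~ q → g · p ~ g · q
    act-~ g pq with ~-elim pq
    ... | K , pK , qK = ~-intro (act-on g pK) (act-on g qK)

    act-opposite : ∀ g {y} → Opposite y → Opposite (g · y)
    act-opposite g {y} x≁y xgy = x≁y (subst₂ _~_ (fix-x (g ⁻¹)) (p-inverseˡ subgroup g y) (act-~ (g ⁻¹) xgy))

    x-off-line : ∀ {y N} → Opposite y → y on N → ¬ x on N
    x-off-line x≁y yN xN = x≁y (~-intro xN yN)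

    meet-perp : ∀ g i {p} → p on g ·ˡ M i → x ~ p → p ≡ g · u i
    meet-perp g i pN xp = project-unique (x-off-line (act-opposite g x≁z) (act-on g (z-on-M i)))
      pN xp (act-on g (u-on-M i)) (~-intro (proj₂ i) (act-on-L g i (u-on i)))

    meet-perp₁ : ∀ i {p} → p on M i → x ~ p → p ≡ u i
    meet-perp₁ i pM xp = project-unique (x-off-line x≁z (z-on-M i)) pM xp (u-on-M i) (x~u i)

    u-off-M : ∀ {i j} → i # j → ¬ u j on M i
    u-off-M {i} {j} i#j uM = cross {i} {j} i#j (u-on i) (u≢x i) (u-on j) (u≢x j) (~-intro (u-on-M i) uM)

    -- Stabilisers of the points `u i` and the lines `M i`.

    P Q : J → Carrier → Set
    P i g = g · u i ≡ u i
    Q i g = g ·ˡ M i ≡ M i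

    Q⊆P : ∀ {i g} → Q i g → P i g
    Q⊆P {i} {g} qg = point-unique (M≢L i) (subst (g · u i on_) qg (act-on g (u-on-M i)))
      (act-on-L g i (u-on i)) (u-on-M i) (u-on i)

    by-sharpness : ∀ {g h} → g · z ≡ h · z → g ≈ h
    by-sharpness {g , Hg} {h , Hh} = sharp z g h x≁z Hg Hh

    -- `g · z` is recovered as the point of `g ·ˡ M i` collinear with `u j = g · u j`; sharpness
    -- does the rest.
    agree : ∀ {i j g h} → i # j → P j g → P j h → g ·ˡ M i ≡ h ·ˡ M i → g ≈ h
    agree {i} {j} {g} {h} i#j pg ph e = by-sharpness {g} {h} (project-unique u∉N
      (act-on g (z-on-M i)) (subst (_~ g · z) pg (act-~ g u~z))
      (subst (h · z on_) (sym e) (act-on h (z-on-M i))) (subst (_~ h · z) ph (act-~ h u~z)))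
      where
      u~z : u j ~ z
      u~z = ~-intro (u-on-M j) (z-on-M j)
      u∉N : ¬ u j on g ·ˡ M i
      u∉N uN = u-off-M i#j (reflect-on (proj₁ g) (subst (_on g ·ˡ M i) (sym pg) uN))

    P-ε : ∀ i → P i ε
    P-ε i = p-id subgroup (u i)

    Q∩P-trivial : ∀ {i j g} → i # j → Q i g → P j g → g ≈ ε
    Q∩P-trivial {i} {j} {g} i#j qg pg = agree {g = g} {ε} i#j pg (P-ε j) (trans qg (sym (l-id subgroup (M i))))

    mover : ∀ {y} → Opposite y → ∃ λ g → g · z ≡ y
    mover {y} x≁y with transitive z y x≁z x≁y
    ... | g , Hg , e = (g , Hg) , e

    -- The image of `M i` is a line through `y` meeting `L_i`, and `M i` is the only such line.
    mover-Q : ∀ i {y} → Opposite y → y on M i → ∃ λ g → Q i g × g · z ≡ y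
    mover-Q i {y} x≁y yM with mover x≁y
    ... | g , e = g , line-to-unique i x≁y (subst (_on g ·ˡ M i) e (act-on g (z-on-M i))) yM
                        (act-on g (u-on-M i)) (act-on-L g i (u-on i)) (u-on-M i) (u-on i) , e

    symmetry : Fin t → Carrier
    symmetry k = 𝕊 k , Sym.inH k

    symmetry-P : ∀ k i → P i (symmetry k)
    symmetry-P k i = Sym.isSym k (u i) (x~u i)

    move-M≢L : ∀ g i → g ·ˡ M i ≢ proj₁ i
    move-M≢L g i e = M≢L i (lf-injective (proj₁ g) (trans e (sym (fix-L g i))))

    -- L_i and the t images of M_i under the symmetries are t + 1 distinct lines on u_i.
    symmetries-transitive : ∀ i {N} → u i on N → N ≢ proj₁ i → ∃ λ k → symmetry k ·ˡ M i ≡ N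
    symmetries-transitive i {N} uN N≢L with third i i
    ... | j , i#j , _ with injective⇒onto (λ K → I (u i) K) (ptLines (u i)) e e-inj e-on N uN
      where
      e : Fin (suc t) → Ln S
      e zero = proj₁ i
      e (suc k) = symmetry k ·ˡ M i
      e-on : ∀ a → u i on e a
      e-on zero = u-on i
      e-on (suc k) = subst (_on symmetry k ·ˡ M i) (symmetry-P k i) (act-on (symmetry k) (u-on-M i))
      e-inj : ∀ {a b} → e a ≡ e b → a ≡ b
      e-inj {zero} {zero} _ = refl
      e-inj {zero} {suc l} eq = ⊥-elim (move-M≢L (symmetry l) i (sym eq))
      e-inj {suc k} {zero} eq = ⊥-elim (move-M≢L (symmetry k) i eq)
      e-inj {suc k} {suc l} eq =
        cong suc (Sym.distinct k l (agree {g = symmetry k} {symmetry l} i#j (symmetry-P k j) (symmetry-P l j) eq))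
    ...   | zero , eq = contradiction (sym eq) N≢L
    ...   | suc k , eq = k , eq

    P-as-symmetry : ∀ i {g} → P i g → ∃ λ k → symmetry k ·ˡ M i ≡ g ·ˡ M i
    P-as-symmetry i {g} pg = symmetries-transitive i
      (subst (_on g ·ˡ M i) pg (act-on g (u-on-M i))) (move-M≢L g i)

    -- Some symmetry moves `M i` exactly as `g` does; both fix `u j`, so `agree` identifies them.
    P∩P⊆Z : ∀ {i j g} → i # j → P i g → P j g → ∀ k → P k g
    P∩P⊆Z {i} {j} {g} i#j pg pg′ k with P-as-symmetry i {g} pg
    ... | l , e = trans (proj₁ (agree {g = g} {symmetry l} i#j pg′ (symmetry-P l j) (sym e)) (u k)) (symmetry-P l k)

    P-normal : ∀ i {g} h → P i g → P i (h ⁻¹ ∙ (g ∙ h))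
    P-normal i {g , Hg} h pg = begin
      (h ⁻¹ ∙ ((g , Hg) ∙ h)) · u i    ≡⟨ ∙-act (h ⁻¹) ((g , Hg) ∙ h) (u i) ⟩
      h ⁻¹ · ((g , Hg) ∙ h) · u i      ≡⟨ cong (h ⁻¹ ·_) (∙-act (g , Hg) h (u i)) ⟩
      -- By (*) `g` fixes every point of `L_i`, in particular `h · u i`.
      h ⁻¹ · (g , Hg) · h · u i        ≡⟨ cong (h ⁻¹ ·_) (star g Hg (u i) (u≢x i) (x~u i) pg (proj₁ i) (proj₂ i)
                                            (u-on i) (h · u i) (act-on-L h i (u-on i))) ⟩
      h ⁻¹ · h · u i                   ≡⟨ p-inverseˡ subgroup h (u i) ⟩
      u i                              ∎
      where open ≡-Reasoning

    left-divide : ∀ g h → h ≈ g ∙ (g ⁻¹ ∙ h)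
    left-divide g h = Group.sym G {g ∙ (g ⁻¹ ∙ h)} {h} (GroupProperties.\\-leftDividesˡ G g h)

    P⊆ZQ : ∀ i {g} → P i g → ∃₂ λ y q → (∀ k → P k y) × Q i q × g ≈ y ∙ q
    P⊆ZQ i {g} pg with P-as-symmetry i {g} pg
    ... | k , e = y , y ⁻¹ ∙ g , symmetry-P k ,
      trans (l-∘ subgroup (y ⁻¹) g (M i)) (trans (cong (y ⁻¹ ·ˡ_) (sym e)) (l-inverseˡ subgroup y (M i))) ,
      left-divide y g
      where
      y : Carrier
      y = symmetry k

    ~-sym : ∀ {p r} → p ~ r → r ~ p
    ~-sym pr with ~-elim pr
    ... | K , pK , rK = ~-intro rK pK

    module _ {i j : J} (i#j : i # j) (h : Carrier) where

      hu : Pt S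
      hu = h · u i

      hu≁u : ¬ hu ~ u j
      hu≁u = cross {i} {j} i#j (act-on-L h i (u-on i)) (act-≢x h (u≢x i)) (u-on j) (u≢x j)

      -- `q` takes `z` to `z′`, so it takes `u i`, the point of `L_i` collinear with `z`, to the one
      -- collinear with `z′`, which is `hu`.
      factor-through : ∀ {z′} → z′ on M j → hu ~ z′ → Opposite z′ → ∃ (λ q → Q j q × q · z ≡ z′) →
                       ∃₂ λ q p → Q j q × P i p × h ≈ q ∙ p
      factor-through {z′} z′M hu~z′ x≁z′ (q , qq , qz≡z′) = q , q ⁻¹ ∙ h , qq ,
        trans (∙-act (q ⁻¹) h (u i)) (trans (cong (q ⁻¹ ·_) (sym qu≡hu)) (p-inverseˡ subgroup q (u i))) ,
        left-divide q h
        where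
        qu≡hu : q · u i ≡ hu
        qu≡hu = project-unique (opposite-off i x≁z′) (act-on-L q i (u-on i))
          (subst (_~ q · u i) qz≡z′ (act-~ q (~-intro (z-on-M i) (u-on-M i))))
          (act-on-L h i (u-on i)) (~-sym hu~z′)

      -- The projection of `hu` to `M j` is opposite `x`: otherwise it would be `u j`, which is not
      -- collinear with `hu`.
      factor : ∃₂ λ q p → Q j q × P i p × h ≈ q ∙ p
      factor = factor-through z′M hu~z′ x≁z′ (mover-Q j x≁z′ z′M)
        where
        foot : ∃ λ r → r on M j × hu ~ r
        foot = project (λ huM → hu≁u (~-intro huM (u-on-M j)))
        z′ : Pt S
        z′ = proj₁ foot
        z′M : z′ on M j
        z′M = proj₁ (proj₂ foot)
        hu~z′ : hu ~ z′
        hu~z′ = proj₂ (proj₂ foot)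
        x≁z′ : Opposite z′
        x≁z′ xz′ = hu≁u (subst (hu ~_) (meet-perp₁ j z′M xz′) hu~z′)

    -- Transversals of `L_i`, `M_j` and an image of `M_j`.

    L∦M : ∀ {i j : J} → i # j → ¬ proj₁ i meets M j
    L∦M {i} {j} i#j (p , pL , pM) =
      u≢x j (point-unique i#j (subst (_on proj₁ i) p≡u pL) (u-on j) (proj₂ i) (proj₂ j))
      where
      p≡u : p ≡ u j
      p≡u = meet-perp₁ j pM (~-intro (proj₂ i) pL)

    hM∦L : ∀ {i j : J} → i # j → ∀ h → ¬ h ·ˡ M j meets proj₁ i
    hM∦L {i} {j} i#j h (p , pN , pL) = L∦M {i} {j} i#j (h ⁻¹ · p , act-on-L (h ⁻¹) i pL , act-on⁻ h pN)

    -- A common point collinear with `x` is both `h · u j` and `u j`. At one opposite `x` the lines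
    -- coincide, as both meet `L_j`, and again `h` fixes `u j`.
    hM∦M : ∀ j h → ¬ P j h → ¬ h ·ˡ M j meets M j
    hM∦M j h ¬ph (p , pN , pM) with T? (collinear S x p)
    ... | yes xp = ¬ph (trans (sym (meet-perp h j pN xp)) (meet-perp₁ j pM xp))
    ... | no x≁p = ¬ph (meet-perp₁ j (subst (h · u j on_) hM≡M (act-on h (u-on-M j))) (~-intro (proj₂ j) hu-on))
      where
      hu-on : h · u j on proj₁ j
      hu-on = act-on-L h j (u-on j)
      hM≡M : h ·ˡ M j ≡ M j
      hM≡M = line-to-unique j x≁p pN pM (act-on h (u-on-M j)) hu-on (u-on-M j) (u-on j)

    module _ {i j : J} (i#j : i # j) (h : Carrier) (¬ph : ¬ P j h) where

      -- `L_j` is always a transversal but has no points opposite `x`, and `M i` would lead to a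
      -- trivial `a`. Since t + 1 ≥ 3, another one is left.
      transversal-line : ∃ λ K → h ·ˡ M j meets K × K meets proj₁ i × K meets M j × K ≢ proj₁ j × K ≢ M i
      transversal-line = let K , hK , K≢L , K≢M = count-avoid f (subst (_≥ 3) (sym f-count) (s≤s t≥2)) (proj₁ j) (M i)
                             a , b = T-elim {meet? (h ·ˡ M j) K} hK
                             c , d = T-elim {meet? K (proj₁ i)} b
                         in K , meet?-elim a , meet?-elim c , meet?-elim d , K≢L , K≢M
        where
        f : Ln S → Bool
        f K = meet? (h ·ˡ M j) K ∧ (meet? K (proj₁ i) ∧ meet? K (M j))
        f-count : count nl f ≡ suc t
        f-count = triad-transversals refl (L∦M {i} {j} i#j) (hM∦L {i} {j} i#j h) (hM∦M j h ¬ph)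

      Transversal : Set
      Transversal = ∃ λ a → ∃₂ λ a′ b′ → Q j a × Q j a′ × Q i b′ × ¬ a ≈ ε × h ∙ a′ ≈ a ∙ b′

      -- A transversal K of L_i, M_j and h M_j other than L_j and M_i carries the points a z ∈ M_j and
      -- h a′ z = a b′ z ∈ h M_j.
      module _ {K : Ln S} {p q r : Pt S} (rN : r on h ·ˡ M j) (rK : r on K) (pK : p on K) (pL : p on proj₁ i)
               (qK : q on K) (qM : q on M j) (K≢L : K ≢ proj₁ j) (K≢M : K ≢ M i) where

        -- Such a `y` would form a triangle with `x` and `p`, forcing `K = L_j`. Hence `K` contains
        -- neither `u j` nor `h · u j`, and `q` and `r` are opposite `x`.
        off-L : ∀ {y} → y on K → y on proj₁ j → y ≢ x → ⊥
        off-L yK yL y≢x = K≢L (line-unique yK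
          (no-triangle i#j (proj₂ i) (proj₂ j) yL yK pK pL) yL (proj₂ j) y≢x)

        x≁q : Opposite q
        x≁q xq = off-L (subst (_on K) (meet-perp₁ j qM xq) qK) (u-on j) (u≢x j)

        x≁r : Opposite r
        x≁r xr = off-L (subst (_on K) (meet-perp h j rN xr) rK) (act-on-L h j (u-on j)) (act-≢x h (u≢x j))

        carried : ∃ (λ a → Q j a × a · z ≡ q) → ∃ (λ a′ → Q j a′ × a′ · z ≡ h ⁻¹ · r) → Transversal
        carried (a , qa , az≡q) (a′ , qa′ , a′z≡) =
          complete (mover-Q i (act-opposite (a ⁻¹) x≁r) (act-on⁻ a (subst (r on_) (sym aM≡K) rK)))
          where
          -- Both lines join `q` to `L_i`.
          aM≡K : a ·ˡ M i ≡ K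
          aM≡K = line-to-unique i x≁q (subst (_on a ·ˡ M i) az≡q (act-on a (z-on-M i))) qK
            (act-on a (u-on-M i)) (act-on-L a i (u-on i)) pK pL
          complete : ∃ (λ b′ → Q i b′ × b′ · z ≡ a ⁻¹ · r) → Transversal
          complete (b′ , qb′ , b′z≡) = a , a′ , b′ , qa , qa′ , qb′ ,
            -- A trivial `a` would make `K` equal to `M i`, which was excluded for this reason.
            (λ a≈ε → K≢M (trans (sym aM≡K) (trans (proj₂ a≈ε (M i)) (l-id subgroup (M i))))) ,
            by-sharpness {h ∙ a′} {a ∙ b′} (begin
              (h ∙ a′) · z       ≡⟨ ∙-act h a′ z ⟩
              h · a′ · z         ≡⟨ cong (h ·_) a′z≡ ⟩
              h · (h ⁻¹) · r     ≡⟨ p-inverseʳ subgroup h r ⟩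
              r                  ≡⟨ sym (p-inverseʳ subgroup a r) ⟩
              a · (a ⁻¹) · r     ≡⟨ cong (a ·_) (sym b′z≡) ⟩
              a · b′ · z         ≡⟨ sym (∙-act a b′ z) ⟩
              (a ∙ b′) · z       ∎)
            where open ≡-Reasoning

      transversal : Transversal
      transversal =
        let K , (r , rN , rK) , (p , pK , pL) , (q , qK , qM) , K≢L , K≢M = transversal-line
        in carried rN rK pK pL qK qM K≢L K≢M
             (mover-Q j (x≁q rN rK pK pL qK qM K≢L K≢M) qM)
             (mover-Q j (act-opposite (h ⁻¹) (x≁r rN rK pK pL qK qM K≢L K≢M)) (act-on⁻ h rN))

    -- Since s + 1 ≥ 3, `M i` has a point besides `z` and `u i`, and some element of `Q i` takes `z`
    -- there.
    nontrivial : ∀ i → ∃ λ b → Q i b × ¬ b ≈ ε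
    nontrivial i with count-avoid (λ p → I p (M i)) (points≥3 (M i)) z (u i)
    ... | y , yM , y≢z , y≢u with mover-Q i (λ xy → y≢u (meet-perp₁ i yM xy)) yM
    ...   | b , qb , bz≡y = b , qb , λ b≈ε → y≢z (trans (sym bz≡y) (trans (proj₁ b≈ε z) (p-id subgroup z)))

    open KantorFamily G J _#_ P Q

    axioms : Axioms
    axioms = record
      { #-sym = ≢-sym
      ; third = third
      ; i₀ = i₀
      ; P-closed = λ i → record
          { resp = λ e pg → trans (sym (proj₁ e (u i))) pg
          ; unit = P-ε i
          ; mult = λ {g} {h} pg ph → trans (∙-act g h (u i)) (trans (cong (g ·_) ph) pg)
          ; inv = λ {g} pg → trans (cong (g ⁻¹ ·_) (sym pg)) (p-inverseˡ subgroup g (u i))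
          }
      ; Q-closed = λ i → record
          { resp = λ e qg → trans (sym (proj₂ e (M i))) qg
          ; unit = l-id subgroup (M i)
          ; mult = λ {g} {h} qg qh → trans (l-∘ subgroup g h (M i)) (trans (cong (g ·ˡ_) qh) qg)
          ; inv = λ {g} qg → trans (cong (g ⁻¹ ·ˡ_) (sym qg)) (l-inverseˡ subgroup g (M i))
          }
      ; P-normal = λ i {g} → P-normal i {g}
      ; Q⊆P = λ {i} {g} → Q⊆P {i} {g}
      ; P∩P⊆Z = λ {i} {j} {g} → P∩P⊆Z {i} {j} {g}
      ; Q∩P-trivial = λ {i} {j} {g} → Q∩P-trivial {i} {j} {g}
      ; trivial? = λ g → trivial? g
      ; nontrivial = nontrivial
      ; P⊆ZQ = λ i {g} → P⊆ZQ i {g}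
      ; factor = factor
      ; transversal = transversal
      }
      where
      trivial? : ∀ g → Dec (g ≈ ε)
      trivial? g with g · z ≟ z
      ... | yes e = yes (by-sharpness {g} {ε} (trans e (sym (p-id subgroup z))))
      ... | no ne = no λ e → ne (trans (proj₁ e z) (p-id subgroup z))

    central : Central S t H 𝕊
    central k h Hh = (λ p → trans (sym (∙-act g h′ p)) (trans (proj₁ gh≈hg p) (∙-act h′ g p))) ,
                     (λ L → trans (sym (l-∘ subgroup g h′ L)) (trans (proj₂ gh≈hg L) (l-∘ subgroup h′ g L)))
      where
      g h′ : Carrier
      g = symmetry k
      h′ = h , Hh
      gh≈hg : g ∙ h′ ≈ h′ ∙ g
      gh≈hg = Z-central axioms {g} (symmetry-P k) h′

mainTheorem13 : (S : IncStr) (t : ℕ) (x : Pt S) (H : Aut S → Set) (𝕊 : Fin t → Aut S) →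
    t ≥ 2 → IsSTGQ S (t * t) t x H 𝕊 → PropertyStar S x H → Central S t H 𝕊
mainTheorem13 S t x H 𝕊 t≥2 stgq star =
  let z , x≁z = opposite-exists in Based.central z x≁z
  where open SkewTranslation S t x H 𝕊 t≥2 stgq star
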